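{- There exists a (deterministic) fully dynamic graph algorithm which maintains a maximal matching of an undirected graph on $n$ vertices, using a lookahead of length $m$, with amortized update cost $O(\log m)$, with constant (that is, $O(1)$) query cost for queries of the form $\mathrm{mate}(u)$, and with setup cost $O(n^2\cdot\log m)$. Here $m$ denotes the maximum number of edges of the graph during its life cycle.
   Context: Graphs are finite and undirected, on a fixed set of $n$ vertices, and are viewed as sets (or lists) of edges; $|G|$ is the number of edges of $G$. A matching of $G$ is a set $M\subseteq G$ of edges with pairwise disjoint sets of endpoints; it is maximal if there is no matching $M'\supsetneq M$ of $G$. Fully dynamic maximal matching problem: the graph is initially empty and undergoes a (possibly arbitrarily long) stream $q_1,q_2,\ldots,q_t$ of updates, each update being either the insertion $+(u,v)$ of one edge or the deletion $-(u,v)$ of one edge. For a graph $G$, $Gq_1\cdots q_i$ denotes the graph obtained from $G$ by applying the updates $q_1,\ldots,q_i$ in order. With $G$ the initial graph, $m:=\max\{|Gq_1q_2\cdots q_i| : 0\le i\le t\}$. After handling each update the algorithm must have a maximal matching $M$ of the current graph. Between the handling of updates, queries $\mathrm{mate}(u)$ may be asked; the answer is the unique vertex $v$ with $(u,v)\in M$ if such a vertex exists, and $\textsc{null}$ otherwise, where $M$ is the current maximal matching. Lookahead of length $m$: at any moment the algorithm may inspect the next $m$ not yet processed operations of the stream. The setup cost is the cost of a one-time initialization at the start of the program, and is not counted in the update cost. The amortized update cost is the total time spent on handling the updates divided by the number of updates. Array entries (indexed by vertices or by pairs of vertices) can be accessed in constant time. -}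

module Defs where

open import Data.Bool.Base using (Bool; if_then_else_; _∧_)
open import Data.Fin.Base as Fin using (Fin; toℕ)
import Data.Fin.Properties as Fin
open import Data.List.Base using (List; []; _∷_; length; take; drop; head; filter)
open import Data.List.Membership.Propositional using (_∈_)
import Data.List.Membership.DecPropositional as DecMembership
import Data.List.Properties as List
open import Data.List.Relation.Binary.Pointwise.Base using (Pointwise)
open import Data.List.Relation.Binary.Subset.Propositional using (_⊆_; _⊈_)
open import Data.Maybe.Base using (Maybe; just; nothing)
open import Data.Maybe.Relation.Unary.Any using (Any)
open import Data.Nat.Base using (ℕ; zero; suc; _+_; _∸_; _*_; _^_; _⊔_; _≤_; _<_; _<ᵇ_; _≡ᵇ_)
open import Data.Nat.ListAction using (product)
open import Data.Nat.Logarithm using (⌊log₂_⌋)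
open import Data.Nat.Properties using (_≟_)
open import Data.Product.Base using (∃-syntax; _×_; _,_)
open import Data.Sum.Base using (_⊎_)
open import Data.Unit.Base using (⊤)
open import Relation.Binary.Definitions using (DecidableEquality)
open import Relation.Binary.PropositionalEquality.Core using (_≡_; _≢_; refl; cong)
open import Relation.Nullary.Decidable.Core using (yes; no; does; ¬?)
open import Relation.Nullary.Negation.Core using (¬_; contradiction)

------------------------------------------------------------------------
-- Graphs on the vertex set Fin n

-- The unordered pair {lo , hi} of two distinct vertices, listed in
-- increasing order so that each undirected edge has one representation.
record Edge (n : ℕ) : Set where
  constructor edge
  field
    lo hi  : Fin n
    .lo<hi : lo Fin.< hi

open Edge public

_≟ₑ_ : ∀ {n} → DecidableEquality (Edge n)
edge a b _ ≟ₑ edge c d _ with a Fin.≟ c | b Fin.≟ d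
... | yes refl | yes refl = yes refl
... | no a≢c   | _        = no λ eq → a≢c (cong lo eq)
... | yes _    | no b≢d   = no λ eq → b≢d (cong hi eq)

_isEndOf_ : ∀ {n} → Fin n → Edge n → Set
u isEndOf e = u ≡ lo e ⊎ u ≡ hi e

Joins : ∀ {n} → Edge n → Fin n → Fin n → Set
Joins e u v = (lo e ≡ u × hi e ≡ v) ⊎ (lo e ≡ v × hi e ≡ u)

-- Graphs reached from [] by applyUpdate have no repeated edges, so for
-- them `length` is the number of edges.
Graph : ℕ → Set
Graph n = List (Edge n)

data Update (n : ℕ) : Set where
  insert delete : Edge n → Update n

-- Inserting a present edge or deleting an absent one has no effect.
applyUpdate : ∀ {n} → Graph n → Update n → Graph n
applyUpdate G (insert e) = if does (DecMembership._∈?_ _≟ₑ_ e G) then G else e ∷ G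
applyUpdate G (delete e) = filter (λ f → ¬? (f ≟ₑ e)) G

-- max { |G q₁ ⋯ qᵢ| : 0 ≤ i ≤ t }
peakSize : ∀ {n} → Graph n → List (Update n) → ℕ
peakSize G []       = length G
peakSize G (q ∷ qs) = length G ⊔ peakSize (applyUpdate G q) qs

record IsMatching {n} (G M : Graph n) : Set where
  field
    sub      : M ⊆ G
    disjoint : ∀ {e f} → e ∈ M → f ∈ M → e ≢ f → ∀ u → ¬ (u isEndOf e × u isEndOf f)

IsMaximalMatching : ∀ {n} → Graph n → Graph n → Set
IsMaximalMatching G M =
  IsMatching G M × ¬ (∃[ M′ ] IsMatching G M′ × M ⊆ M′ × M′ ⊈ M)

-- `nothing` is the answer null.
IsMate : ∀ {n} → Graph n → Fin n → Maybe (Fin n) → Set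
IsMate M u (just v) = ∃[ e ] e ∈ M × Joins e u v
IsMate M u nothing  = ∀ v e → e ∈ M → ¬ Joins e u v

------------------------------------------------------------------------
-- A word RAM with arrays, presented as a while-language
--
-- A program is a finite piece of syntax using finitely many registers and
-- named multidimensional arrays.  Every syntax node evaluated costs one time
-- unit, and allocating an array also costs its number of entries.  Programs
-- get stuck, rather than continue with a junk value, on access outside an
-- allocated array and on any literal or arithmetic result that does not fit
-- in a machine word.

Reg Arr : Set
Reg = ℕ
Arr = ℕ

data BinOp : Set where
  add sub mul lt eq : BinOp

data Field : Set where
  kind fst snd : Field

data Expr : Set where
  lit  : ℕ → Expr
  reg  : Reg → Expr
  op   : BinOp → Expr → Expr → Expr
  get  : Arr → List Expr → Expr
  -- peek f e is field f of operation number e, counting from 0, among the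
  -- upcoming operations visible to the program, and 0 if there is none.
  peek : Field → Expr → Expr

infixr 4 _⨾_

data Cmd : Set where
  skip  : Cmd
  _⨾_   : Cmd → Cmd → Cmd
  set   : Reg → Expr → Cmd
  put   : Arr → List Expr → Expr → Cmd
  alloc : Arr → List Expr → Cmd
  ifte  : Expr → Cmd → Cmd → Cmd
  while : Expr → Cmd → Cmd

bit : Bool → ℕ
bit b = if b then 1 else 0

⟦_⟧ : BinOp → ℕ → ℕ → ℕ
⟦ add ⟧ x y = x + y
⟦ sub ⟧ x y = x ∸ y
⟦ mul ⟧ x y = x * y
⟦ lt  ⟧ x y = bit (x <ᵇ y)
⟦ eq  ⟧ x y = bit (x ≡ᵇ y)

record Heap : Set where
  constructor heap
  field
    shape : Arr → Maybe (List ℕ)   -- side lengths; nothing if unallocated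
    entry : Arr → List ℕ → ℕ

open Heap public

record State : Set where
  constructor ⟨_,_⟩
  field
    regs : Reg → ℕ
    mem  : Heap

open State public

emptyHeap : Heap
emptyHeap = heap (λ _ → nothing) (λ _ _ → 0)

InBounds : Heap → Arr → List ℕ → Set
InBounds h a is = Any (Pointwise _<_ is) (shape h a)

setReg : Reg → ℕ → State → State
setReg x v s = ⟨ (λ y → if does (x ≟ y) then v else regs s y) , mem s ⟩

putEntry : Arr → List ℕ → ℕ → State → State
putEntry a is v ⟨ r , heap sh en ⟩ =
  ⟨ r , heap sh (λ b js → if does (a ≟ b) ∧ does (List.≡-dec _≟_ is js) then v else en b js) ⟩

allocArr : Arr → List ℕ → State → State
allocArr a ds ⟨ r , heap sh en ⟩ =
  ⟨ r , heap (λ b → if does (a ≟ b) then just ds else sh b)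
             (λ b js → if does (a ≟ b) then 0 else en b js) ⟩

-- An insertion has kind 1 and a deletion kind 2, so kind 0 marks the end of the
-- visible operations.
fieldOf : ∀ {n} → Field → Maybe (Update n) → ℕ
fieldOf _    nothing           = 0
fieldOf kind (just (insert _)) = 1
fieldOf kind (just (delete _)) = 2
fieldOf fst  (just (insert e)) = toℕ (lo e)
fieldOf fst  (just (delete e)) = toℕ (lo e)
fieldOf snd  (just (insert e)) = toℕ (hi e)
fieldOf snd  (just (delete e)) = toℕ (hi e)

exprCost  : Expr → ℕ
exprsCost : List Expr → ℕ
exprCost (lit _)    = 1
exprCost (reg _)    = 1
exprCost (op _ e f) = suc (exprCost e + exprCost f)
exprCost (get _ es) = suc (exprsCost es)
exprCost (peek _ e) = suc (exprCost e)
exprsCost []        = 0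
exprsCost (e ∷ es)  = exprCost e + exprsCost es

-- Word values are the numbers below `limit`; `window` lists the visible
-- upcoming operations.
module Machine {n : ℕ} (limit : ℕ) (window : List (Update n)) where

  eval  : State → Expr → ℕ
  evals : State → List Expr → List ℕ
  eval s (lit k)    = k
  eval s (reg x)    = regs s x
  eval s (op o e f) = ⟦ o ⟧ (eval s e) (eval s f)
  eval s (get a es) = entry (mem s) a (evals s es)
  eval s (peek f e) = fieldOf f (head (drop (eval s e) window))
  evals s []        = []
  evals s (e ∷ es)  = eval s e ∷ evals s es

  Safe  : State → Expr → Set
  Safes : State → List Expr → Set
  Safe s (lit k)    = k < limit
  Safe s (reg _)    = ⊤
  Safe s (op o e f) = Safe s e × Safe s f × ⟦ o ⟧ (eval s e) (eval s f) < limit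
  Safe s (get a es) = Safes s es × InBounds (mem s) a (evals s es)
  Safe s (peek _ e) = Safe s e
  Safes s []        = ⊤
  Safes s (e ∷ es)  = Safe s e × Safes s es

  -- Exec c s s′ k : started in s, c terminates in s′ at cost k.
  data Exec : Cmd → State → State → ℕ → Set where
    skip    : ∀ {s} → Exec skip s s 1
    seq     : ∀ {c d s s′ s″ k l} → Exec c s s′ k → Exec d s′ s″ l →
              Exec (c ⨾ d) s s″ (suc (k + l))
    set     : ∀ {x e s} → Safe s e →
              Exec (set x e) s (setReg x (eval s e) s) (suc (exprCost e))
    put     : ∀ {a es e s} → Safes s es → InBounds (mem s) a (evals s es) → Safe s e →
              Exec (put a es e) s (putEntry a (evals s es) (eval s e) s)
                   (suc (exprsCost es + exprCost e))
    alloc   : ∀ {a es s} → Safes s es →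
              Exec (alloc a es) s (allocArr a (evals s es) s)
                   (suc (exprsCost es + product (evals s es)))
    if-then : ∀ {e c d s s′ k} → Safe s e → eval s e ≢ 0 → Exec c s s′ k →
              Exec (ifte e c d) s s′ (suc (exprCost e + k))
    if-else : ∀ {e c d s s′ k} → Safe s e → eval s e ≡ 0 → Exec d s s′ k →
              Exec (ifte e c d) s s′ (suc (exprCost e + k))
    stop    : ∀ {e c s} → Safe s e → eval s e ≡ 0 →
              Exec (while e c) s s (suc (exprCost e))
    loop    : ∀ {e c s s′ s″ k l} → Safe s e → eval s e ≢ 0 →
              Exec c s s′ k → Exec (while e c) s′ s″ l →
              Exec (while e c) s s″ (suc (exprCost e + (k + l)))

  -- Algorithms are deterministic: "some execution" and "every terminating
  -- execution" are interchangeable below.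
  deterministic : ∀ {c s s₁ s₂ k₁ k₂} → Exec c s s₁ k₁ → Exec c s s₂ k₂ →
                  s₁ ≡ s₂ × k₁ ≡ k₂
  deterministic skip skip = refl , refl
  deterministic (seq p q) (seq p′ q′) with deterministic p p′
  ... | refl , refl with deterministic q q′
  ...   | refl , refl = refl , refl
  deterministic (set _) (set _) = refl , refl
  deterministic (put _ _ _) (put _ _ _) = refl , refl
  deterministic (alloc _) (alloc _) = refl , refl
  deterministic (if-then _ _ p) (if-then _ _ p′) with deterministic p p′
  ... | refl , refl = refl , refl
  deterministic (if-then _ ≢0 _) (if-else _ ≡0 _) = contradiction ≡0 ≢0
  deterministic (if-else _ ≡0 _) (if-then _ ≢0 _) = contradiction ≡0 ≢0
  deterministic (if-else _ _ p) (if-else _ _ p′) with deterministic p p′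
  ... | refl , refl = refl , refl
  deterministic (stop _ _) (stop _ _) = refl , refl
  deterministic (stop _ ≡0) (loop _ ≢0 _ _) = contradiction ≡0 ≢0
  deterministic (loop _ ≢0 _ _) (stop _ ≡0) = contradiction ≡0 ≢0
  deterministic (loop _ _ p q) (loop _ _ p′ q′) with deterministic p p′
  ... | refl , refl with deterministic q q′
  ...   | refl , refl = refl , refl

------------------------------------------------------------------------
-- Dynamic matching algorithms

record Algorithm : Set where
  field
    setup handle query : Cmd

open Algorithm public

-- Only the heap persists between program runs; registers are local to a run.
args₀ : Reg → ℕ
args₀ _ = 0

args₁ : ℕ → Reg → ℕ
args₁ x zero    = x
args₁ x (suc _) = 0

args₂ : ℕ → ℕ → Reg → ℕ
args₂ x y zero          = x
args₂ x y (suc zero)    = y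
args₂ x y (suc (suc _)) = 0

encode : ∀ {n} → Maybe (Fin n) → ℕ
encode nothing  = 0
encode (just v) = suc (toℕ v)

-- `m` is the lookahead length and `limit` the word limit.
module _ (A : Algorithm) (n m limit : ℕ) where

  open Machine {n} limit using (Exec)

  -- The next m operations; during the handling of an update, that update is
  -- itself not yet processed and so counts as the first of them.
  lookahead : List (Update n) → List (Update n)
  lookahead qs = take m qs

  -- setup receives n and m in registers 0 and 1.
  Setup : List (Update n) → Heap → ℕ → Set
  Setup qs h k = ∃[ r ] Exec (lookahead qs) (setup A) ⟨ args₂ n m , emptyHeap ⟩ ⟨ r , h ⟩ k

  -- The algorithm reads the update to be handled at the front of the window.
  Handle : List (Update n) → Heap → Heap → ℕ → Set
  Handle qs h h′ k = ∃[ r ] Exec (lookahead qs) (handle A) ⟨ args₀ , h ⟩ ⟨ r , h′ ⟩ k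

  -- u is passed, and the answer returned, in register 0.  The heap is left as
  -- it was, so any number of queries may be asked between two updates.
  Query : List (Update n) → Heap → Fin n → Maybe (Fin n) → ℕ → Set
  Query qs h u v k =
    ∃[ r ] Exec (lookahead qs) (query A) ⟨ args₁ (toℕ u) , h ⟩ ⟨ r , h ⟩ k × r 0 ≡ encode v

  -- The heap h holds a maximal matching of G, and every mate query about it
  -- costs at most b; qs are the updates still to come.
  HasMaximalMatching : ℕ → List (Update n) → Heap → Graph n → Set
  HasMaximalMatching b qs h G =
    ∃[ M ] IsMaximalMatching G M ×
      (∀ u → ∃[ v ] ∃[ k ] IsMate M u v × Query qs h u v k × k ≤ b)

  -- Maintains b qs h G k : from heap h, with current graph G, handling qs
  -- costs k in total, and there is a maximal matching, with queries costing
  -- at most b, before qs and after each of its updates.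
  data Maintains (b : ℕ) : List (Update n) → Heap → Graph n → ℕ → Set where
    done : ∀ {h G} → HasMaximalMatching b [] h G → Maintains b [] h G 0
    step : ∀ {q qs h h′ G k l} →
           HasMaximalMatching b (q ∷ qs) h G →
           Handle (q ∷ qs) h h′ k →
           Maintains b qs h′ (applyUpdate G q) l →
           Maintains b (q ∷ qs) h G (k + l)

-- Numbers of w · log₂(n + m + 2) bits, for a constant w.
wordLimit : ℕ → ℕ → ℕ → ℕ
wordLimit w n m = (2 + n + m) ^ w

-- log m, made positive at m ≤ 1, where O(log m) would otherwise mean cost 0.
lg : ℕ → ℕ
lg m = suc ⌊log₂ m ⌋

{-# OPTIONS --safe #-}
module Submission where

-- The stream is cut into phases of L = 2^J ≤ m updates.  A buffer holds the
-- edges present at the start of the phase followed by the updates of the phase,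
-- read by lookahead.  With w the largest power of two dividing the index s of an
-- update within the phase, that update discards the matched edges touched in a
-- window of 2w - 1 buffer positions centred at s and rematches the edges of
-- the window greedily, those whose next update in the window comes last first.
-- An edge not touched by a dyadic block of updates then always meets a matched
-- edge not touched by the block, which for blocks of length one is maximality.
-- The windows of a phase have total length O(L log L), and starting a phase
-- costs O(m) = O(L).

open import Defs
open import Data.Bool.Base using (true; false; T; if_then_else_)
import Data.Fin.Base as Fin
open Fin using (Fin; toℕ)
import Data.Fin.Properties as Fin
open import Data.List.Base using (List; []; _∷_; length; take; drop; head; filter; lookup)
import Data.List.Membership.DecPropositional as DecMembership
open import Data.List.Membership.Propositional using (_∈_)
open import Data.List.Membership.Propositional.Properties using (∈-filter⁺; ∈-filter⁻; ∈-lookup)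
import Data.List.Properties as List
open import Data.List.Relation.Binary.Pointwise.Base using (Pointwise; []; _∷_)
open import Data.List.Relation.Binary.Subset.Propositional using (_⊆_)
import Data.List.Relation.Unary.All as All
open import Data.List.Relation.Unary.All.Properties.Core using (¬Any⇒All¬)
open import Data.List.Relation.Unary.AllPairs using ([]; _∷_)
import Data.List.Relation.Unary.Any as ListAny
open import Data.List.Relation.Unary.Any using (here; there)
open import Data.List.Relation.Unary.Unique.Propositional using (Unique)
import Data.List.Relation.Unary.Unique.Propositional.Properties as Unique
open import Data.Maybe.Base using (Maybe; just; nothing)
open import Data.Maybe.Relation.Unary.Any using (Any; just)
open import Data.Nat.Base hiding (_!)
open import Data.Nat.ListAction using (product)
open import Data.Nat.Logarithm using (⌊log₂_⌋; ⌊log₂⌋-mono-≤; ⌊log₂[2^n]⌋≡n)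
open import Data.Nat.Properties
open import Data.Nat.Tactic.RingSolver using (solve-∀)
open import Data.Empty using (⊥; ⊥-elim)
open import Data.Product.Base using (∃-syntax; _×_; _,_; proj₁; proj₂)
open import Data.Sum.Base using (_⊎_; inj₁; inj₂; map)
open import Data.Unit.Base using (⊤; tt)
open import Relation.Binary.PropositionalEquality
  using (_≡_; _≢_; refl; sym; trans; cong; cong₂; cong-app; subst)
open import Relation.Nullary.Decidable using (yes; no; does; dec-true; dec-false; ¬?; recompute)
open import Relation.Nullary.Negation.Core using (¬_; contradiction)

-- The obstacle is that a rematching must serve many later windows at once. The order of the greedy
-- step settles this: when an edge with next update at `r` is tried, every edge matched so far has
-- no update before `r`, so whatever blocks it is a good cover for each window that starts just
-- after the current update and ends at some `z ≤ r`. One rematching thus establishes `Dominated`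
-- for all prefixes of the second half of its window, while domination of every larger window
-- persists.
--
-- The recursion over dyadic blocks needs a start. The update of index 0 in a phase has no largest
-- power of two; its window is the whole buffer. Since every present edge occurs there, no present
-- edge is untouched by that window and its domination holds vacuously. This is why the buffer
-- contains the old edges besides the updates. Repetitions and deleted edges have to be removed from
-- it between phases, or it would grow with the stream instead of staying within `2 m`.

bit≢0 : ∀ {b} → bit b ≢ 0 → T b
bit≢0 {true}  _ = tt
bit≢0 {false} h = contradiction refl h

bit≡0 : ∀ {b} → bit b ≡ 0 → ¬ T b
bit≡0 {false} _ ()

bit≤1 : ∀ b → bit b ≤ 1
bit≤1 true  = ≤-refl
bit≤1 false = z≤n

-- Total correctness with cost bounds for the while-language

module Hoare {n : ℕ} (limit : ℕ) (4≤limit : 4 ≤ limit) (window : List (Update n)) where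

  open Machine {n} limit window

  record Eval (s : State) (e : Expr) (v : ℕ) : Set where
    constructor ev
    field
      safe : Safe s e
      val  : eval s e ≡ v

  record Evals (s : State) (es : List Expr) (vs : List ℕ) : Set where
    constructor evs
    field
      safes : Safes s es
      vals  : evals s es ≡ vs

  record Run (c : Cmd) (s : State) (b : ℕ) (Q : State → Set) : Set where
    constructor run
    field
      {final} : State
      {cost}  : ℕ
      exec    : Exec c s final cost
      cost≤   : cost ≤ b
      post    : Q final

  bit<limit : ∀ b → bit b < limit
  bit<limit b = ≤-trans (s≤s (bit≤1 b)) (≤-trans (s≤s (s≤s z≤n)) 4≤limit)

  module _ {s : State} where

    e-lit : ∀ k → k < limit → Eval s (lit k) k
    e-lit k k< = ev k< refl

    e-0 : Eval s (lit 0) 0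
    e-0 = ev (≤-trans (s≤s z≤n) 4≤limit) refl

    e-1 : Eval s (lit 1) 1
    e-1 = ev (≤-trans (s≤s (s≤s z≤n)) 4≤limit) refl

    e-reg : ∀ {x v} → regs s x ≡ v → Eval s (reg x) v
    e-reg e≡ = ev tt e≡

    e-add : ∀ {e f a b} → Eval s e a → Eval s f b → a + b < limit → Eval s (op add e f) (a + b)
    e-add (ev p refl) (ev q refl) l< = ev (p , q , l<) refl

    e-sub : ∀ {e f a b} → Eval s e a → Eval s f b → a < limit → Eval s (op sub e f) (a ∸ b)
    e-sub {a = a} {b} (ev p refl) (ev q refl) l< = ev (p , q , <-≤-trans (s≤s (m∸n≤m a b)) l<) refl

    e-lt : ∀ {e f a b} → Eval s e a → Eval s f b → Eval s (op lt e f) (bit (a <ᵇ b))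
    e-lt (ev p refl) (ev q refl) = ev (p , q , bit<limit _) refl

    e-eq : ∀ {e f a b} → Eval s e a → Eval s f b → Eval s (op eq e f) (bit (a ≡ᵇ b))
    e-eq (ev p refl) (ev q refl) = ev (p , q , bit<limit _) refl

    e-get : ∀ {a es vs ds v} → Evals s es vs → shape (mem s) a ≡ just ds → Pointwise _<_ vs ds →
            entry (mem s) a vs ≡ v → Eval s (get a es) v
    e-get {a} {vs = vs} (evs p refl) sh l< e≡ =
      ev (p , subst (Any (Pointwise _<_ vs)) (sym sh) (just l<)) e≡

    e-peek : ∀ {f e k} → Eval s e k → Eval s (peek f e) (fieldOf f (head (drop k window)))
    e-peek (ev p refl) = ev p refl

    e-≡ : ∀ {e v w} → Eval s e v → v ≡ w → Eval s e w
    e-≡ p refl = p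

    e1 : ∀ {e v} → Eval s e v → Evals s (e ∷ []) (v ∷ [])
    e1 (ev p refl) = evs (p , tt) refl

    e2 : ∀ {e f v w} → Eval s e v → Eval s f w → Evals s (e ∷ f ∷ []) (v ∷ w ∷ [])
    e2 (ev p refl) (ev q refl) = evs (p , q , tt) refl

    run-set : ∀ {x e v Q} → Eval s e v → Q (setReg x v s) → Run (set x e) s (suc (exprCost e)) Q
    run-set (ev p refl) q = run (set p) ≤-refl q

    run-put : ∀ {a es e vs ds v Q} → Evals s es vs → shape (mem s) a ≡ just ds → Pointwise _<_ vs ds →
              Eval s e v → Q (putEntry a vs v s) → Run (put a es e) s (suc (exprsCost es + exprCost e)) Q
    run-put {vs = vs} (evs p refl) sh l< (ev q refl) post =
      run (put p (subst (Any (Pointwise _<_ vs)) (sym sh) (just l<)) q) ≤-refl post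

    run-alloc : ∀ {a es ds Q} → Evals s es ds → Q (allocArr a ds s) →
                Run (alloc a es) s (suc (exprsCost es + product ds)) Q
    run-alloc (evs p refl) post = run (alloc p) ≤-refl post

    run-skip : ∀ {Q : State → Set} → Q s → Run skip s 1 Q
    run-skip = run skip ≤-refl

    -- The postcondition of the first command is itself a run of the second, so a program is
    -- verified by nesting these rules and intermediate assertions need not be written out.
    run-seq : ∀ {c d b b′ Q} → Run c s b (λ t → Run d t b′ Q) → Run (c ⨾ d) s (suc (b + b′)) Q
    run-seq (run p k≤ (run q l≤ post)) = run (seq p q) (s≤s (+-mono-≤ k≤ l≤)) post

    run-if : ∀ {e c d v b Q} → Eval s e v → (v ≢ 0 → Run c s b Q) → (v ≡ 0 → Run d s b Q) →
             Run (ifte e c d) s (suc (exprCost e + b)) Q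
    run-if {e} {v = zero} (ev p e≡) _ f with f refl
    ... | run q k≤ post = run (if-else p e≡ q) (s≤s (+-monoʳ-≤ (exprCost e) k≤)) post
    run-if {e} {v = suc v} (ev p e≡) f _ with f (λ ())
    ... | run q k≤ post = run (if-then p (λ e≡′ → 1+n≢0 (trans (sym e≡) e≡′)) q)
                              (s≤s (+-monoʳ-≤ (exprCost e) k≤)) post

    run-stop : ∀ {e c v Q} → Eval s e v → v ≡ 0 → Q s → Run (while e c) s (suc (exprCost e)) Q
    run-stop (ev p refl) v≡0 q = run (stop p v≡0) ≤-refl q

    run-loop : ∀ {e c v b b′ Q} → Eval s e v → v ≢ 0 → Run c s b (λ t → Run (while e c) t b′ Q) →
               Run (while e c) s (suc (exprCost e + (b + b′))) Q
    run-loop {e} (ev p refl) v≢0 (run q k≤ (run q′ l≤ post)) =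
      run (loop p v≢0 q q′) (s≤s (+-monoʳ-≤ (exprCost e) (+-mono-≤ k≤ l≤))) post

    run-mono : ∀ {c b b′ Q Q′} → Run c s b Q → b ≤ b′ → (∀ {t} → Q t → Q′ t) → Run c s b′ Q′
    run-mono (run p k≤ post) b≤ f = run p (≤-trans k≤ b≤) (f post)

    run-≤ : ∀ {c b b′ Q} → Run c s b Q → b ≤ b′ → Run c s b′ Q
    run-≤ r b≤ = run-mono r b≤ λ q → q

-- Register 3 is decremented before `body`, which therefore sees `h - 1` down to `l`. The downward
-- direction matters twice: the earliest position of a pair is the one whose stamp remains, and
-- pairs with the latest next update are matched first.
descend : Expr → Expr → Cmd → Cmd
descend l h body =
  set 3 h ⨾ while (op lt l (reg 3)) (set 3 (op sub (reg 3) (lit 1)) ⨾ body)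

descendCost : Expr → Expr → ℕ → ℕ → ℕ
descendCost l h b k = 5 + exprCost h + exprCost l + k * (8 + exprCost l + b)

module Loops {n : ℕ} (limit : ℕ) (4≤limit : 4 ≤ limit) (window : List (Update n)) where

  open Machine {n} limit window
  open Hoare {n} limit 4≤limit window

  module _ (I : ℕ → State → Set) {le he : Expr} {body : Cmd} {l b : ℕ}
           (counter : ∀ {r t} → I r t → regs t 3 ≡ r)
           (bottom  : ∀ {r t} → I r t → Eval t le l)
    where

    run-countdown : ∀ k {t} → k + l < limit →
      (∀ r t → l ≤ r → r < k + l → I (suc r) t → Run body (setReg 3 r t) b (I r)) →
      I (k + l) t →
      Run (while (op lt le (reg 3)) (set 3 (op sub (reg 3) (lit 1)) ⨾ body)) t
          (3 + exprCost le + k * (8 + exprCost le + b)) (I l)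
    run-countdown zero {t} _ _ i with e-lt (bottom i) (e-reg {s = t} {x = 3} (counter i))
    ... | ev p e≡ = run (stop p (trans e≡ (l≮l l)))
                        (≤-reflexive (trans (cong (2 +_) (+-comm (exprCost le) 1)) (sym (+-identityʳ _)))) i
      where
      l≮l : ∀ l → bit (l <ᵇ l) ≡ 0
      l≮l l with l <ᵇ l in e≡
      ... | true  = contradiction (<ᵇ⇒< l l (subst T (sym e≡) tt)) (<-irrefl refl)
      ... | false = refl
    run-countdown (suc k) {t} k< spec i
      with e-lt (bottom i) (e-reg {s = t} {x = 3} (counter i)) | e-sub (e-reg {x = 3} (counter i)) (e-1 {s = t}) k<
         | spec (k + l) t (m≤n+m l k) ≤-refl i
    ... | ev p e≡ | ev q e≡′ | run {t₁} {k₁} p′ k≤ i′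
      with run-countdown k (<-trans (n<1+n _) k<) (λ r t l≤ r< → spec r t l≤ (<-trans r< (n<1+n _))) i′
    ... | run p″ l≤ j =
      run (loop p (λ z → 0≢1+n (trans (sym (trans (sym e≡) z)) (bit-true _ _ (s≤s (m≤n+m l k)))))
                (seq (set q) (subst (λ r → Exec body (setReg 3 r t) t₁ k₁) (sym e≡′) p′)) p″)
          (≤-trans (s≤s (+-monoʳ-≤ (suc (exprCost le + 1)) (+-mono-≤ (s≤s (+-monoʳ-≤ 4 k≤)) l≤))) (≤-reflexive (lemma (exprCost le) b k))) j
      where
      bit-true : ∀ a b → a < b → bit (a <ᵇ b) ≡ 1
      bit-true a b a<b with a <ᵇ b | <⇒<ᵇ a<b
      ... | true | _ = refl
      lemma : ∀ c b k → suc (suc (c + 1) + (suc (4 + b) + (3 + c + k * (8 + c + b))))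
                      ≡ 3 + c + suc k * (8 + c + b)
      lemma = solve-∀

    run-descend : ∀ k {h t} → h ≡ k + l → h < limit → Eval t he h → I h (setReg 3 h t) →
      (∀ r t → l ≤ r → r < h → I (suc r) t → Run body (setReg 3 r t) b (I r)) →
      Run (descend le he body) t (descendCost le he b k) (I l)
    run-descend k refl h< he⇓ i spec =
      run-≤ (run-seq (run-set he⇓ (run-countdown k h< spec i))) (≤-reflexive (lemma (exprCost he) (exprCost le) b k))
      where
      lemma : ∀ a c b k → suc (suc a + (3 + c + k * (8 + c + b))) ≡ 5 + a + c + k * (8 + c + b)
      lemma = solve-∀

-- Arrays, and the effect of the passes on matching and stamps

Array : Set
Array = List ℕ → ℕ

infix 10 _!_
infix 9 _!!_,_

_!_ : Array → ℕ → ℕ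
f ! i = f (i ∷ [])

_!!_,_ : Array → ℕ → ℕ → ℕ
f !! i , j = f (i ∷ j ∷ [])

update : List ℕ → ℕ → Array → Array
update is v f js = if does (List.≡-dec _≟_ is js) then v else f js

module _ {is : List ℕ} {v : ℕ} (f : Array) where

  update-≡ : update is v f is ≡ v
  update-≡ rewrite dec-true (List.≡-dec _≟_ is is) refl = refl

  update-≢ : ∀ {js} → is ≢ js → update is v f js ≡ f js
  update-≢ {js} is≢js rewrite dec-false (List.≡-dec _≟_ is js) is≢js = refl

update0-suc : ∀ is f js {q} → update is 0 f js ≡ suc q → is ≢ js × f js ≡ suc q
update0-suc is f js e with List.≡-dec _≟_ is js
... | no is≢js = is≢js , e

∷-≢ : ∀ {i j : ℕ} → i ≢ j → _≢_ {A = List ℕ} (i ∷ []) (j ∷ [])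
∷-≢ i≢j refl = i≢j refl

head-cases : ∀ {lo} r → lo ≤ r → r ≡ lo ⊎ suc lo ≤ r
head-cases r lo≤r with m≤n⇒m<n∨m≡n lo≤r
... | inj₁ lo<r = inj₂ lo<r
... | inj₂ refl = inj₁ refl

Sym : Array → Set
Sym mt = ∀ p q → mt ! p ≡ suc q → mt ! q ≡ suc p

-- Mate entries name neighbours; the adjacency matrix stores an edge only at
-- its increasing pair of endpoints.
Valid : Array → Array → Set
Valid A mt = ∀ p q → mt ! p ≡ suc q → A !! p , q ≢ 0 ⊎ A !! q , p ≢ 0

Grow : Array → Array → Set
Grow mt mt′ = ∀ p q → mt ! p ≡ suc q → mt′ ! p ≡ suc q

module Buffer (bu bv : Array) where

  Hit : ℕ → ℕ → ℕ → Set
  Hit r u v = bu ! r ≡ u × bv ! r ≡ v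

  Untouched : ℕ → ℕ → ℕ → ℕ → Set
  Untouched x y u v = ∀ r → x ≤ r → r < y → ¬ Hit r u v

  -- Buffer slots list the smaller end first, whereas mate entries occur in both orientations; a
  -- pair read off the mate array must be absent in either order.
  Untouched₂ : ℕ → ℕ → ℕ → ℕ → Set
  Untouched₂ x y u v = Untouched x y u v × Untouched x y v u

  Covered : Array → ℕ → ℕ → ℕ → Set
  Covered mt x y p = ∃[ q ] mt ! p ≡ suc q × Untouched₂ x y p q

  -- The invariant of the algorithm; for x = y it says that the matching is
  -- maximal.
  Dominated : Array → Array → ℕ → ℕ → Set
  Dominated A mt x y =
    ∀ u v → A !! u , v ≢ 0 → Untouched x y u v → Covered mt x y u ⊎ Covered mt x y v

  module _ {x x′ y y′ : ℕ} (x≤x′ : x ≤ x′) (y′≤y : y′ ≤ y) where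

    untouched-⊆ : ∀ {u v} → Untouched x y u v → Untouched x′ y′ u v
    untouched-⊆ un r x′≤r r<y′ = un r (≤-trans x≤x′ x′≤r) (<-≤-trans r<y′ y′≤y)

    untouched₂-⊆ : ∀ {u v} → Untouched₂ x y u v → Untouched₂ x′ y′ u v
    untouched₂-⊆ (un , un′) = untouched-⊆ un , untouched-⊆ un′

    covered-⊆ : ∀ mt {p} → Covered mt x y p → Covered mt x′ y′ p
    covered-⊆ _ (q , e , un) = q , e , untouched₂-⊆ un

  covered-grow : ∀ mt mt′ → Grow mt mt′ → ∀ {x y p} → Covered mt x y p → Covered mt′ x y p
  covered-grow _ _ g (q , e , un) = q , g _ q e , un

  untouched-empty : ∀ {x u v} → Untouched x x u v
  untouched-empty r x≤r r<x = contradiction (<-≤-trans r<x x≤r) (<-irrefl refl)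

  untouched-∷ : ∀ {r hi u v} → ¬ Hit r u v → Untouched (suc r) hi u v → Untouched r hi u v
  untouched-∷ ¬h un r′ r≤ r′< h with head-cases r′ r≤
  ... | inj₁ refl = ¬h h
  ... | inj₂ r<   = un r′ r< r′< h

  untouched-++ : ∀ {x y z u v} → Untouched x y u v → Untouched y z u v → Untouched x z u v
  untouched-++ {y = y} un un′ r x≤r r<z with r <? y
  ... | yes r<y = un r x≤r r<y
  ... | no  r≮y = un′ r (≮⇒≥ r≮y) r<z

  -- `keep` is what preserves domination of larger windows; `gone` lets the rematching start from
  -- edges that have no update in the window.
  record Cleared (lo hi : ℕ) (mt mt′ : Array) : Set where
    field
      sym′ : Sym mt′
      back : ∀ p q → mt′ ! p ≡ suc q → mt ! p ≡ suc q
      gone : ∀ p q → mt′ ! p ≡ suc q → Untouched lo hi p q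
      keep : ∀ p q → mt ! p ≡ suc q → Untouched₂ lo hi p q → mt′ ! p ≡ suc q

    gone₂ : ∀ p q → mt′ ! p ≡ suc q → Untouched₂ lo hi p q
    gone₂ p q e = gone p q e , gone q p (sym′ p q e)

  cleared-empty : ∀ {hi mt} → Sym mt → Cleared hi hi mt mt
  cleared-empty s = record
    { sym′ = s ; back = λ _ _ e → e ; gone = λ _ _ _ → untouched-empty ; keep = λ _ _ e _ → e }

  cleared-++ : ∀ {x y z mt mt′ mt″} → x ≤ y → y ≤ z → Cleared x y mt mt′ → Cleared y z mt′ mt″ → Cleared x z mt mt″
  cleared-++ x≤y y≤z c d = record
    { sym′ = D.sym′
    ; back = λ p q e → C.back p q (D.back p q e)
    ; gone = λ p q e → untouched-++ (C.gone p q (D.back p q e)) (D.gone p q e)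
    ; keep = λ p q e un → D.keep p q (C.keep p q e (untouched₂-⊆ ≤-refl y≤z un)) (untouched₂-⊆ x≤y ≤-refl un)
    }
    where
    module C = Cleared c
    module D = Cleared d

  cleared-skip : ∀ {r hi mt mt′} → mt′ ! (bu ! r) ≢ suc (bv ! r) →
                 Cleared (suc r) hi mt mt′ → Cleared r hi mt mt′
  cleared-skip {r} ≢suc c = record
    { sym′ = sym′
    ; back = back
    ; gone = λ p q e → untouched-∷ (λ { (refl , refl) → ≢suc e }) (gone p q e)
    ; keep = λ p q e un → keep p q e (untouched₂-⊆ (n≤1+n r) ≤-refl un)
    }
    where open Cleared c

  -- Symmetry survives since both entries of the edge are erased: a third vertex pointing at `u` or
  -- `v` would, by symmetry, have to be the partner that `u` or `v` already has.
  cleared-unmatch : ∀ {r hi mt mt′} → r < hi → mt′ ! (bu ! r) ≡ suc (bv ! r) → Cleared (suc r) hi mt mt′ →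
                    Cleared r hi mt (update (bv ! r ∷ []) 0 (update (bu ! r ∷ []) 0 mt′))
  cleared-unmatch {r} {hi} {mt} {mt′} r<hi ≡suc c = record
    { sym′ = λ p q e → let u≢p , v≢p , e′ = old p q e in
        new q p (λ { refl → v≢p (suc-injective (trans (sym ≡suc) (sym′ p q e′))) })
                (λ { refl → u≢p (suc-injective (trans (sym (sym′ _ _ ≡suc)) (sym′ p q e′))) })
                (sym′ p q e′)
    ; back = λ p q e → back p q (proj₂ (proj₂ (old p q e)))
    ; gone = λ p q e → let u≢p , _ , e′ = old p q e in
        untouched-∷ (λ { (refl , _) → u≢p refl }) (gone p q e′)
    ; keep = λ p q e un →
        let e′ = keep p q e (untouched₂-⊆ (n≤1+n r) ≤-refl un) in
        new p q (λ { refl → proj₁ un r ≤-refl r<hi (refl , suc-injective (trans (sym ≡suc) e′)) })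
                (λ { refl → proj₂ un r ≤-refl r<hi (suc-injective (trans (sym (sym′ _ _ ≡suc)) e′) , refl) })
                e′
    }
    where
    open Cleared c
    u = bu ! r
    v = bv ! r
    mt″ = update (v ∷ []) 0 (update (u ∷ []) 0 mt′)
    old : ∀ p q → mt″ ! p ≡ suc q → u ≢ p × v ≢ p × mt′ ! p ≡ suc q
    old p q e with update0-suc (v ∷ []) (update (u ∷ []) 0 mt′) (p ∷ []) e
    ... | v≢ , e′ with update0-suc (u ∷ []) mt′ (p ∷ []) e′
    ... | u≢ , e″ = (λ { refl → u≢ refl }) , (λ { refl → v≢ refl }) , e″
    new : ∀ p q → u ≢ p → v ≢ p → mt′ ! p ≡ suc q → mt″ ! p ≡ suc q
    new p q u≢ v≢ e = trans (update-≢ (update (u ∷ []) 0 mt′) (∷-≢ v≢)) (trans (update-≢ mt′ (∷-≢ u≢)) e)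

  -- The stamp of a pair is the value attached to its first position in the
  -- stamped interval; the pass runs downwards, so the first position wins.
  Stamped : (ℕ → ℕ) → ℕ → ℕ → Array → Array → Set
  Stamped val lo hi nx nx′ = ∀ u v →
    (Untouched lo hi u v × nx′ !! u , v ≡ nx !! u , v) ⊎
    (∃[ r ] lo ≤ r × r < hi × Hit r u v × Untouched lo r u v × nx′ !! u , v ≡ val r)

  stamped-empty : ∀ {val hi nx} → Stamped val hi hi nx nx
  stamped-empty u v = inj₁ (untouched-empty , refl)

  stamped-∷ : ∀ {val r hi} nx nx′ → r < hi → Stamped val (suc r) hi nx nx′ →
              Stamped val r hi nx (update (bu ! r ∷ bv ! r ∷ []) (val r) nx′)
  stamped-∷ {val} {r} nx nx′ r<hi st u v with List.≡-dec _≟_ (bu ! r ∷ bv ! r ∷ []) (u ∷ v ∷ [])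
  ... | yes refl = inj₂ (r , ≤-refl , r<hi , (refl , refl) , untouched-empty , update-≡ nx′)
  ... | no ≢uv with st u v
  ...   | inj₁ (un , e) = inj₁ (untouched-∷ (λ { (refl , refl) → ≢uv refl }) un , trans (update-≢ nx′ ≢uv) e)
  ...   | inj₂ (r′ , r<r′ , r′<hi , h , un , e) =
    inj₂ (r′ , <⇒≤ r<r′ , r′<hi , h , untouched-∷ (λ { (refl , refl) → ≢uv refl }) un , trans (update-≢ nx′ ≢uv) e)

  -- `Z r` is a position before which the pair tried at slot `r` has no update from `b` on: the end
  -- of the window for pairs without a further update there, and `r` itself for pairs whose next
  -- update is `r`. As `Z` does not increase while the pass descends, `late` holds for all matched
  -- edges at once.
  record Tried (A nx : Array) (val Z : ℕ → ℕ) (b lo hi : ℕ) (mt mt′ : Array) : Set where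
    field
      sym′    : Sym mt′
      valid   : Valid A mt′
      grow    : Grow mt mt′
      late    : ∀ p q → mt′ ! p ≡ suc q → Untouched₂ b (Z lo) p q
      covered : ∀ r → lo ≤ r → r < hi → nx !! bu ! r , bv ! r ≡ val r → A !! bu ! r , bv ! r ≢ 0 →
                Covered mt′ b (Z r) (bu ! r) ⊎ Covered mt′ b (Z r) (bv ! r)

  tried-empty : ∀ {A nx val Z b hi mt} → Sym mt → Valid A mt →
                (∀ p q → mt ! p ≡ suc q → Untouched₂ b (Z hi) p q) → Tried A nx val Z b hi hi mt mt
  tried-empty s v l = record
    { sym′ = s ; valid = v ; grow = λ _ _ e → e ; late = l
    ; covered = λ r lo≤ r< → contradiction (<-≤-trans r< lo≤) (<-irrefl refl) }

  module _ {A nx val Z b r hi mt mt′} (Zr≤ : Z r ≤ Z (suc r))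
           (t : Tried A nx val Z b (suc r) hi mt mt′) where

    open Tried t

    private
      u = bu ! r
      v = bv ! r

    -- When an end is already taken, `late` says that the blocking edge has no update before `Z r`,
    -- so the blocked pair is covered. The other reasons to skip, a foreign stamp or an absent edge,
    -- make `blocked` vacuous.
    tried-skip : (nx !! u , v ≡ val r → A !! u , v ≢ 0 →
                  (∃[ q ] mt′ ! u ≡ suc q) ⊎ (∃[ q ] mt′ ! v ≡ suc q)) → Tried A nx val Z b r hi mt mt′
    tried-skip blocked = record
      { sym′ = sym′ ; valid = valid ; grow = grow ; late = late′
      ; covered = λ r′ r≤ r′< → λ nx≡ A≢ → cov r′ r≤ r′< nx≡ A≢ }
      where
      late′ : ∀ p q → mt′ ! p ≡ suc q → Untouched₂ b (Z r) p q
      late′ p q e = untouched₂-⊆ ≤-refl Zr≤ (late p q e)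
      cov : ∀ r′ → r ≤ r′ → r′ < hi → nx !! bu ! r′ , bv ! r′ ≡ val r′ → A !! bu ! r′ , bv ! r′ ≢ 0 →
            Covered mt′ b (Z r′) (bu ! r′) ⊎ Covered mt′ b (Z r′) (bv ! r′)
      cov r′ r≤ r′< nx≡ A≢ with head-cases r′ r≤
      ... | inj₂ r<r′ = covered r′ r<r′ r′< nx≡ A≢
      ... | inj₁ refl = map (λ (q , e) → q , e , late′ _ q e) (λ (q , e) → q , e , late′ _ q e) (blocked nx≡ A≢)

    tried-match : u ≢ v → A !! u , v ≢ 0 → Untouched₂ b (Z r) u v →
                  mt′ ! u ≡ 0 → mt′ ! v ≡ 0 →
                  Tried A nx val Z b r hi mt (update (v ∷ []) (suc u) (update (u ∷ []) (suc v) mt′))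
    tried-match u≢v Auv un u0 v0 = record
      { sym′ = λ p q e → sym-case p q (cases p q e)
      ; valid = λ p q e → valid-case p q (cases p q e)
      ; grow = λ p q e → grow′ p q (grow p q e)
      ; late = λ p q e → late-case p q (cases p q e)
      ; covered = λ r′ r≤ r′< nx≡ A≢ → cov r′ (head-cases r′ r≤) r′< nx≡ A≢ }
      where
      mt″ = update (v ∷ []) (suc u) (update (u ∷ []) (suc v) mt′)
      at-v : mt″ ! v ≡ suc u
      at-v = update-≡ {v ∷ []} (update (u ∷ []) (suc v) mt′)
      at-u : mt″ ! u ≡ suc v
      at-u = trans (update-≢ (update (u ∷ []) (suc v) mt′) (∷-≢ (λ e → u≢v (sym e)))) (update-≡ {u ∷ []} mt′)
      elsewhere : ∀ p → u ≢ p → v ≢ p → mt″ ! p ≡ mt′ ! p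
      elsewhere p u≢ v≢ = trans (update-≢ (update (u ∷ []) (suc v) mt′) (∷-≢ v≢)) (update-≢ mt′ (∷-≢ u≢))
      grow′ : Grow mt′ mt″
      grow′ p q e = trans (elsewhere p (λ { refl → 0≢1+n (trans (sym u0) e) })
                                       (λ { refl → 0≢1+n (trans (sym v0) e) })) e
      Cases : ℕ → ℕ → Set
      Cases p q = (p ≡ u × q ≡ v) ⊎ (p ≡ v × q ≡ u) ⊎ mt′ ! p ≡ suc q
      cases : ∀ p q → mt″ ! p ≡ suc q → Cases p q
      cases p q e with u ≟ p | v ≟ p
      ... | yes refl | _        = inj₁ (refl , suc-injective (trans (sym e) at-u))
      ... | no _     | yes refl = inj₂ (inj₁ (refl , suc-injective (trans (sym e) at-v)))
      ... | no u≢    | no v≢    = inj₂ (inj₂ (trans (sym (elsewhere p u≢ v≢)) e))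
      sym-case : ∀ p q → Cases p q → mt″ ! q ≡ suc p
      sym-case p q (inj₁ (refl , refl))        = at-v
      sym-case p q (inj₂ (inj₁ (refl , refl))) = at-u
      sym-case p q (inj₂ (inj₂ e))             = grow′ q p (sym′ p q e)
      valid-case : ∀ p q → Cases p q → A !! p , q ≢ 0 ⊎ A !! q , p ≢ 0
      valid-case p q (inj₁ (refl , refl))        = inj₁ Auv
      valid-case p q (inj₂ (inj₁ (refl , refl))) = inj₂ Auv
      valid-case p q (inj₂ (inj₂ e))             = valid p q e
      late-case : ∀ p q → Cases p q → Untouched₂ b (Z r) p q
      late-case p q (inj₁ (refl , refl))        = un
      late-case p q (inj₂ (inj₁ (refl , refl))) = proj₂ un , proj₁ un
      late-case p q (inj₂ (inj₂ e))             = untouched₂-⊆ ≤-refl Zr≤ (late p q e)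
      cov : ∀ r′ → r′ ≡ r ⊎ suc r ≤ r′ → r′ < hi → nx !! bu ! r′ , bv ! r′ ≡ val r′ → A !! bu ! r′ , bv ! r′ ≢ 0 →
            Covered mt″ b (Z r′) (bu ! r′) ⊎ Covered mt″ b (Z r′) (bv ! r′)
      cov r′ (inj₁ refl) _ _ _ = inj₁ (v , at-u , un)
      cov r′ (inj₂ r<r′) r′< nx≡ A≢ = map (covered-grow mt′ mt″ grow′) (covered-grow mt′ mt″ grow′) (covered r′ r<r′ r′< nx≡ A≢)

  module Sweep (A A′ mt₀ mt₁ nx₀ nx₁ nx₂ : Array) {x b y : ℕ}
           (x≤b : x ≤ b) (b≤y : b ≤ y) (0<b : 0 < b)
           (A≡    : ∀ u v → Untouched x y u v → A′ !! u , v ≡ A !! u , v)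
           (clear : Cleared x y mt₀ mt₁)
           (early : Stamped (λ _ → 0) x b nx₀ nx₁)
           (future : Stamped (λ r → r) b y nx₁ nx₂)
    where

    -- The first stamping pass overwrites stamps left by older windows with 0. The second writes
    -- positions that are at least `b`, hence positive, so a 0 that remains was not touched by it.
    stamp-early : ∀ r → x ≤ r → r < b → nx₂ !! bu ! r , bv ! r ≡ 0 → Untouched b y (bu ! r) (bv ! r)
    stamp-early r _ _ nx≡0 with future (bu ! r) (bv ! r)
    ... | inj₁ (un , _) = un
    ... | inj₂ (r′ , b≤r′ , _ , _ , _ , e) =
      contradiction (<-≤-trans 0<b (≤-trans b≤r′ (≤-reflexive (trans (sym e) nx≡0)))) (<-irrefl refl)

    -- A pair occurring several times from `b` on carries the first of these positions, so it is
    -- tried at that one slot only.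
    stamp-future : ∀ r → b ≤ r → r < y → nx₂ !! bu ! r , bv ! r ≡ r → Untouched b r (bu ! r) (bv ! r)
    stamp-future r b≤r r<y nx≡r with future (bu ! r) (bv ! r)
    ... | inj₁ (un , _) = contradiction (refl , refl) (un r b≤r r<y)
    ... | inj₂ (r′ , _ , _ , _ , un , e) with trans (sym e) nx≡r
    ... | refl = un

    -- The updated edge lies in the window and is unmatched by the time its adjacency entry changes,
    -- so a deletion cannot leave a matched non-edge behind.
    cleared-valid : Valid A mt₀ → Valid A′ mt₁
    cleared-valid valid p q e = map (λ ≢0 e′ → ≢0 (trans (sym (A≡ p q (proj₁ un))) e′))
                                     (λ ≢0 e′ → ≢0 (trans (sym (A≡ q p (proj₂ un))) e′))
                                     (valid p q (back p q e))
      where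
      open Cleared clear
      un = gone₂ p q e

    module _ (mt₂ mt₃ : Array)
             (try₁ : Tried A′ nx₂ (λ _ → 0) (λ _ → y) b x b mt₁ mt₂)
             (try₂ : Tried A′ nx₂ (λ r → r) (λ r → r) b b y mt₂ mt₃)
      where

      private
        module T₁ = Tried try₁
        module T₂ = Tried try₂

      grow₁₃ : Grow mt₁ mt₃
      grow₁₃ p q e = T₂.grow p q (T₁.grow p q e)

      -- An edge and its cover that avoid the larger window also avoid `[x, y)`: the adjacency of
      -- the edge is unchanged, and the cover survives both the discarding and the rematching.
      dominated-outer : ∀ {x′ y′} → x′ ≤ x → y ≤ y′ → Dominated A mt₀ x′ y′ → Dominated A′ mt₃ x′ y′
      dominated-outer {x′} {y′} x′≤x y≤y′ dom u v A≢ un =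
        map survive survive (dom u v (λ e → A≢ (trans (A≡ u v (untouched-⊆ x′≤x y≤y′ un)) e)) un)
        where
        survive : ∀ {p} → Covered mt₀ x′ y′ p → Covered mt₃ x′ y′ p
        survive {p} (q , e , un) =
          q , grow₁₃ p q (Cleared.keep clear p q e (untouched₂-⊆ x′≤x y≤y′ un)) , un

      -- The next update of the edge decides. At `r` in `[b, y)`: being untouched up to `z` forces
      -- `z ≤ r`, and the second matching pass yields a cover good up to `r`. None there but an
      -- occurrence in `[x, b)`: the first pass yields a cover good up to `y`. None in the window:
      -- the old domination of `[x, y)` has persisted.
      dominated-inner : Dominated A mt₀ x y → ∀ {z} → b ≤ z → z ≤ y → Dominated A′ mt₃ b z
      dominated-inner dom {z} b≤z z≤y u v A≢ un with future u v
      ... | inj₂ (r , b≤r , r<y , (refl , refl) , unr , e) with z ≤? r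
      ...   | no z≰r = contradiction (refl , refl) (un r b≤r (≰⇒> z≰r))
      ...   | yes z≤r = map (covered-⊆ ≤-refl z≤r mt₃) (covered-⊆ ≤-refl z≤r mt₃) (T₂.covered r b≤r r<y e A≢)
      dominated-inner dom {z} b≤z z≤y u v A≢ un | inj₁ (unby , e) with early u v
      ... | inj₂ (r , x≤r , r<b , (refl , refl) , _ , e′) =
        map later later (T₁.covered r x≤r r<b (trans e e′) A≢)
        where
        later : ∀ {p} → Covered mt₂ b y p → Covered mt₃ b z p
        later c = covered-grow mt₂ mt₃ T₂.grow (covered-⊆ ≤-refl z≤y mt₂ c)
      ... | inj₁ (unxb , _) =
        map later later (dominated-outer ≤-refl ≤-refl dom u v A≢ (untouched-++ unxb unby))
        where
        later : ∀ {p} → Covered mt₃ x y p → Covered mt₃ b z p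
        later = covered-⊆ x≤b z≤y mt₃

-- Memory layout and the single passes as programs

-- Position r of the buffer is the pair BU[r], BV[r], and MATE stores vertices
-- plus one.  CT stores, in order, the position of the next update, the end of
-- the buffer, L, and the position of the first update of the phase.
ADJ MATE NEXT BU BV TAB CT : Arr
ADJ  = 0
MATE = 1
NEXT = 2
BU   = 3
BV   = 4
TAB  = 5
CT   = 6

loadPair : Cmd
loadPair = set 4 (get BU (reg 3 ∷ [])) ⨾ set 5 (get BV (reg 3 ∷ []))

clearStep tryStep : Expr → Cmd
clearStep stamp =
  loadPair ⨾
  ifte (op eq (get MATE (reg 4 ∷ [])) (op add (reg 5) (lit 1)))
       (put MATE (reg 4 ∷ []) (lit 0) ⨾ put MATE (reg 5 ∷ []) (lit 0))
       skip ⨾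
  put NEXT (reg 4 ∷ reg 5 ∷ []) stamp
tryStep stamp =
  loadPair ⨾
  ifte (op eq (get NEXT (reg 4 ∷ reg 5 ∷ [])) stamp)
    (ifte (get ADJ (reg 4 ∷ reg 5 ∷ []))
      (ifte (get MATE (reg 4 ∷ [])) skip
        (ifte (get MATE (reg 5 ∷ [])) skip
          (put MATE (reg 4 ∷ []) (op add (reg 5) (lit 1)) ⨾
           put MATE (reg 5 ∷ []) (op add (reg 4) (lit 1)))))
      skip)
    skip

SameRegs SameArrays : List ℕ → State → State → Set
SameRegs []       s t = ⊤
SameRegs (x ∷ xs) s t = regs t x ≡ regs s x × SameRegs xs s t
SameArrays []       s t = ⊤
SameArrays (a ∷ as) s t = entry (mem t) a ≡ entry (mem s) a × SameArrays as s t

-- The two lists name what is preserved; array shapes always are.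
Frame : List Reg → List Arr → State → State → Set
Frame xs as s t = shape (mem t) ≡ shape (mem s) × SameRegs xs s t × SameArrays as s t

same-regs-trans : ∀ xs {s t t′} → SameRegs xs s t → SameRegs xs t t′ → SameRegs xs s t′
same-regs-trans []       _        _          = tt
same-regs-trans (x ∷ xs) (e , es) (e′ , es′) = trans e′ e , same-regs-trans xs es es′

same-arrays-trans : ∀ as {s t t′} → SameArrays as s t → SameArrays as t t′ → SameArrays as s t′
same-arrays-trans []       _        _          = tt
same-arrays-trans (a ∷ as) (e , es) (e′ , es′) = trans e′ e , same-arrays-trans as es es′

frame-trans : ∀ xs as {s t t′} → Frame xs as s t → Frame xs as t t′ → Frame xs as s t′
frame-trans xs as (e , es , fs) (e′ , es′ , fs′) =
  trans e′ e , same-regs-trans xs es es′ , same-arrays-trans as fs fs′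

record Shapes (n B m : ℕ) (sh : Arr → Maybe (List ℕ)) : Set where
  field
    adj  : sh ADJ  ≡ just (n ∷ n ∷ [])
    mate : sh MATE ≡ just (n ∷ [])
    next : sh NEXT ≡ just (n ∷ n ∷ [])
    bu   : sh BU   ≡ just (B ∷ [])
    bv   : sh BV   ≡ just (B ∷ [])
    tab  : sh TAB  ≡ just (m ∷ [])
    ct   : sh CT   ≡ just (4 ∷ [])

<1 : ∀ {i d} → i < d → Pointwise _<_ (i ∷ []) (d ∷ [])
<1 p = p ∷ []

<2 : ∀ {i j d e} → i < d → j < e → Pointwise _<_ (i ∷ j ∷ []) (d ∷ e ∷ [])
<2 p q = p ∷ q ∷ []

-- The first inequality is weak because lookahead past the end of the stream reads as the pair
-- `(0 , 0)`. That pair is never an edge, so trying it has no effect.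
PairRange : ℕ → ℕ → Array → Array → Set
PairRange n E bu bv = ∀ r → r < E → bu ! r ≤ bv ! r × bv ! r < n

module Passes {n : ℕ} (m limit : ℕ) (cap : 4 + n + (m + m) ≤ limit) (window : List (Update n)) where

  fits : ∀ {k} → k ≤ 3 + n + (m + m) → k < limit
  fits k≤ = ≤-trans (s≤s k≤) cap

  n≤cap : ∀ {k} → k ≤ n → k ≤ 3 + n + (m + m)
  n≤cap k≤ = ≤-trans k≤ (≤-trans (m≤n+m n 3) (m≤m+n (3 + n) (m + m)))

  B≤cap : ∀ {k} → k ≤ 3 + (m + m) → k ≤ 3 + n + (m + m)
  B≤cap k≤ = ≤-trans k≤ (+-monoʳ-≤ 3 (m≤n+m (m + m) n))

  4≤limit : 4 ≤ limit
  4≤limit = ≤-trans (s≤s (s≤s (s≤s (s≤s z≤n)))) cap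

  open Hoare {n} limit 4≤limit window public
  open Loops {n} limit 4≤limit window public

  kept : List Arr
  kept = BU ∷ BV ∷ ADJ ∷ TAB ∷ CT ∷ []

  module Pass {s₀ : State} (sh : Shapes n (m + m) m (shape (mem s₀)))
              {le he stamp : Expr} {l h E : ℕ} (val : ℕ → ℕ) (h≤E : h ≤ E) (E≤ : E ≤ m + m)
              {bu bv : Array} (bu₀ : entry (mem s₀) BU ≡ bu) (bv₀ : entry (mem s₀) BV ≡ bv)
              (range : PairRange n E bu bv)
              (stamp⇓ : ∀ {t r} → regs t 3 ≡ r → Eval t stamp (val r))
              (le⇓ : ∀ {t} → Frame (0 ∷ 1 ∷ 2 ∷ []) kept s₀ t → Eval t le l)
              (he⇓ : Eval s₀ he h)
    where

    open Buffer bu bv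

    private
      mt₀ = entry (mem s₀) MATE
      nx₀ = entry (mem s₀) NEXT

    module S = Shapes sh

    shape⇓ : ∀ {sh′} → sh′ ≡ shape (mem s₀) → ∀ {a ds} → shape (mem s₀) a ≡ just ds → sh′ a ≡ just ds
    shape⇓ refl e = e

    ClearInv : ℕ → State → Set
    ClearInv r t = regs t 3 ≡ r × Frame (0 ∷ 1 ∷ 2 ∷ []) kept s₀ t ×
                   Cleared r h mt₀ (entry (mem t) MATE) × Stamped val r h nx₀ (entry (mem t) NEXT)

    clear-step : ∀ r t → l ≤ r → r < h → ClearInv (suc r) t →
                 Run (clearStep stamp) (setReg 3 r t) (26 + exprCost stamp) (ClearInv r)
    clear-step r t _ r<h (_ , fr , cl , st) =
      run-seq (run-seq (run-set (e-get (e1 (e-reg refl)) (shape⇓ sh≡ S.bu) (<1 r<) (cong-app (trans bu≡ bu₀) _))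
                       (run-set (e-get (e1 (e-reg refl)) (shape⇓ sh≡ S.bv) (<1 r<) (cong-app (trans bv≡ bv₀) _))
      (run-seq (run-if (e-eq (e-get (e1 (e-reg refl)) (shape⇓ sh≡ S.mate) (<1 u<n) refl)
                             (e-add (e-reg refl) e-1 v+1<))
        (λ same → run-seq (run-put (e1 (e-reg refl)) (shape⇓ sh≡ S.mate) (<1 u<n) e-0
                         (run-put (e1 (e-reg refl)) (shape⇓ sh≡ S.mate) (<1 v<n) e-0
                           (stampIt _ refl refl refl fr (cleared-unmatch r<h (matched same) cl) st))))
        (λ differ → run-≤ (run-skip (stampIt _ refl refl refl fr (cleared-skip (unmatched differ) cl) st)) (s≤s z≤n)))))))
      where
      u = bu ! r
      v = bv ! r
      sh≡ = proj₁ fr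
      bu≡ = proj₁ (proj₂ (proj₂ fr))
      bv≡ = proj₁ (proj₂ (proj₂ (proj₂ fr)))
      r<E = <-≤-trans r<h h≤E
      r< = <-≤-trans r<E E≤
      v<n = proj₂ (range r r<E)
      u<n = ≤-<-trans (proj₁ (range r r<E)) v<n
      v+1< : v + 1 < limit
      v+1< = fits (n≤cap (subst (_≤ n) (+-comm 1 v) v<n))
      matched : ∀ {x} → bit (x ≡ᵇ v + 1) ≢ 0 → x ≡ suc v
      matched {x} ne = trans (≡ᵇ⇒≡ x (v + 1) (bit≢0 ne)) (+-comm v 1)
      unmatched : ∀ {x} → bit (x ≡ᵇ v + 1) ≡ 0 → x ≢ suc v
      unmatched {x} e refl = bit≡0 e (≡⇒≡ᵇ x (v + 1) (+-comm 1 v))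
      stampIt : ∀ t′ → regs t′ 3 ≡ r → regs t′ 4 ≡ u → regs t′ 5 ≡ v →
                Frame (0 ∷ 1 ∷ 2 ∷ []) kept s₀ t′ →
                Cleared r h mt₀ (entry (mem t′) MATE) → Stamped val (suc r) h nx₀ (entry (mem t′) NEXT) →
                Run (put NEXT (reg 4 ∷ reg 5 ∷ []) stamp) t′ (3 + exprCost stamp) (ClearInv r)
      stampIt t′ r3 r4 r5 fr′ cl′ st′ =
        run-put (e2 (e-reg r4) (e-reg r5)) (shape⇓ (proj₁ fr′) S.next) (<2 u<n v<n) (stamp⇓ r3)
                (r3 , fr′ , cl′ , stamped-∷ nx₀ (entry (mem t′) NEXT) r<h st′)

    h<limit : h < limit
    h<limit = fits (B≤cap (≤-trans h≤E (≤-trans E≤ (m≤n+m (m + m) 3))))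

    frame₀ : Frame (0 ∷ 1 ∷ 2 ∷ []) kept s₀ s₀
    frame₀ = refl , (refl , refl , refl , tt) , (refl , refl , refl , refl , refl , tt)

    run-clear : ∀ k → h ≡ k + l → Sym mt₀ →
      Run (descend le he (clearStep stamp)) s₀ (descendCost le he (26 + exprCost stamp) k)
          (λ t → Frame (0 ∷ 1 ∷ 2 ∷ []) kept s₀ t ×
                 Cleared l h mt₀ (entry (mem t) MATE) × Stamped val l h nx₀ (entry (mem t) NEXT))
    run-clear k h≡ sym₀ =
      run-mono (run-descend ClearInv proj₁ (λ i → le⇓ (proj₁ (proj₂ i))) k h≡ h<limit he⇓
                  (refl , frame₀ , cleared-empty sym₀ , stamped-empty {val} {h} {nx₀})
                  clear-step)
               ≤-refl proj₂

    module _ {b : ℕ} {Z : ℕ → ℕ} {A nx : Array} (A₀≡ : entry (mem s₀) ADJ ≡ A) (nx₀≡ : entry (mem s₀) NEXT ≡ nx)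
             (ordered : ∀ u v → A !! u , v ≢ 0 → u < v)
             (Z≤E : ∀ r → r < h → Z r ≤ E)
             (Z-mono : ∀ r → Z r ≤ Z (suc r))
             (fresh : ∀ r → l ≤ r → r < h → nx !! bu ! r , bv ! r ≡ val r → Untouched b (Z r) (bu ! r) (bv ! r))
      where

      TryInv : ℕ → State → Set
      TryInv r t = regs t 3 ≡ r × Frame (0 ∷ 1 ∷ 2 ∷ []) (NEXT ∷ kept) s₀ t ×
                   Tried A nx val Z b r h mt₀ (entry (mem t) MATE)

      try-step : ∀ r t → l ≤ r → r < h → TryInv (suc r) t →
                 Run (tryStep stamp) (setReg 3 r t) (34 + exprCost stamp) (TryInv r)
      try-step r t l≤r r<h (_ , fr , tr) =
        run-≤ (run-seq (run-seq (run-set (e-get (e1 (e-reg refl)) (shape⇓ sh≡ S.bu) (<1 r<) (cong-app (trans bu≡ bu₀) _))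
                         (run-set (e-get (e1 (e-reg refl)) (shape⇓ sh≡ S.bv) (<1 r<) (cong-app (trans bv≡ bv₀) _))
        (run-if (e-eq (e-get (e2 (e-reg refl) (e-reg refl)) (shape⇓ sh≡ S.next) (<2 u<n v<n) (cong-app (trans nx≡ nx₀≡) _))
                      (stamp⇓ refl))
          (λ same → run-if (e-get (e2 (e-reg refl) (e-reg refl)) (shape⇓ sh≡ S.adj) (<2 u<n v<n) (cong-app (trans A≡ A₀≡) _))
            (λ present → run-if (e-get (e1 (e-reg refl)) (shape⇓ sh≡ S.mate) (<1 u<n) refl)
              (λ busy → run-≤ (run-skip (refl , fr , tried-skip (Z-mono r) tr (λ _ _ → inj₁ (suc≢0 busy)))) (s≤s z≤n))
              (λ free → run-if (e-get (e1 (e-reg refl)) (shape⇓ sh≡ S.mate) (<1 v<n) refl)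
                (λ busy → run-≤ (run-skip (refl , fr , tried-skip (Z-mono r) tr (λ _ _ → inj₂ (suc≢0 busy)))) (s≤s z≤n))
                (λ free′ → run-seq
                  (run-put (e1 (e-reg refl)) (shape⇓ sh≡ S.mate) (<1 u<n) (e-≡ (e-add (e-reg refl) e-1 v+1<) (+-comm v 1))
                  (run-put (e1 (e-reg refl)) (shape⇓ sh≡ S.mate) (<1 v<n) (e-≡ (e-add (e-reg refl) e-1 u+1<) (+-comm u 1))
                    (refl , fr , tried-match (Z-mono r) tr (λ e → <-irrefl e (ordered u v present)) present
                                   (untouched₂ same present) free free′))))))
            (λ absent → run-≤ (run-skip (refl , fr , tried-skip (Z-mono r) tr (λ _ A≢ → contradiction absent A≢))) (s≤s z≤n)))
          (λ differ → run-≤ (run-skip (refl , fr , tried-skip (Z-mono r) tr (λ nx≡val → contradiction nx≡val (mismatch differ)))) (s≤s z≤n)))))))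
         (≤-reflexive (cong (13 +_) (+-comm (exprCost stamp) 21)))
        where
        u = bu ! r
        v = bv ! r
        sh≡ = proj₁ fr
        nx≡ = proj₁ (proj₂ (proj₂ fr))
        bu≡ = proj₁ (proj₂ (proj₂ (proj₂ fr)))
        bv≡ = proj₁ (proj₂ (proj₂ (proj₂ (proj₂ fr))))
        A≡  = proj₁ (proj₂ (proj₂ (proj₂ (proj₂ (proj₂ fr)))))
        r<E = <-≤-trans r<h h≤E
        r< = <-≤-trans r<E E≤
        v<n = proj₂ (range r r<E)
        u<n = ≤-<-trans (proj₁ (range r r<E)) v<n
        v+1< : v + 1 < limit
        v+1< = fits (n≤cap (subst (_≤ n) (+-comm 1 v) v<n))
        u+1< : u + 1 < limit
        u+1< = fits (n≤cap (subst (_≤ n) (+-comm 1 u) u<n))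
        suc≢0 : ∀ {x} → x ≢ 0 → ∃[ q ] x ≡ suc q
        suc≢0 {zero}  x≢0 = contradiction refl x≢0
        suc≢0 {suc q} _   = q , refl
        mismatch : ∀ {x y} → bit (x ≡ᵇ y) ≡ 0 → x ≢ y
        mismatch {x} e refl = bit≡0 e (≡⇒≡ᵇ x x refl)
        untouched₂ : bit (nx !! u , v ≡ᵇ val r) ≢ 0 → A !! u , v ≢ 0 → Untouched₂ b (Z r) u v
        untouched₂ same present =
          fresh r l≤r r<h (≡ᵇ⇒≡ (nx !! u , v) (val r) (bit≢0 same)) ,
          -- The reversed pair cannot occur in the buffer: slots have their smaller end first and
          -- `u < v`.
          λ r′ b≤r′ r′<Z (bu≡v , bv≡u) →
              <⇒≱ (ordered u v present)
                  (subst (_≤ u) bu≡v (subst (bu ! r′ ≤_) bv≡u (proj₁ (range r′ (<-≤-trans r′<Z (Z≤E r r<h))))))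

      run-try : ∀ k → h ≡ k + l → Sym mt₀ → Valid A mt₀ →
        (∀ p q → mt₀ ! p ≡ suc q → Untouched₂ b (Z h) p q) →
        Run (descend le he (tryStep stamp)) s₀ (descendCost le he (34 + exprCost stamp) k)
            (λ t → Frame (0 ∷ 1 ∷ 2 ∷ []) (NEXT ∷ kept) s₀ t × Tried A nx val Z b l h mt₀ (entry (mem t) MATE))
      run-try k h≡ sym₀ valid₀ late₀ =
        run-mono (run-descend TryInv proj₁ (λ (_ , (sh≡ , rs , _ , as) , _) → le⇓ (sh≡ , rs , as)) k h≡ h<limit he⇓
                    (refl , (proj₁ frame₀ , proj₁ (proj₂ frame₀) , refl , proj₂ (proj₂ frame₀)) , tried-empty sym₀ valid₀ late₀)
                    try-step)
                 ≤-refl proj₂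

-- Refreshing the matching on one window

-- Registers 0, 1 and 2 hold the position of the update and the bounds of the
-- window.  A pair is stamped with the position of its next update in the window,
-- or with 0 if there is none (positions after the current one are positive), so
-- that the second pair of passes tries every pair at the right moment only.
refresh : Cmd
refresh =
  descend (reg 1) (op add (reg 0) (lit 1)) (clearStep (lit 0)) ⨾
  descend (op add (reg 0) (lit 1)) (reg 2) (clearStep (reg 3)) ⨾
  put ADJ (peek fst (lit 0) ∷ peek snd (lit 0) ∷ []) (op eq (peek kind (lit 0)) (lit 1)) ⨾
  descend (reg 1) (op add (reg 0) (lit 1)) (tryStep (lit 0)) ⨾
  descend (op add (reg 0) (lit 1)) (reg 2) (tryStep (reg 3))

target : ∀ {n} → Update n → Edge n
target (insert e) = e
target (delete e) = e

applyAdj : ∀ {n} → Update n → Array → Array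
applyAdj q = update (toℕ (lo (target q)) ∷ toℕ (hi (target q)) ∷ []) (bit (fieldOf kind (just q) ≡ᵇ 1))

Ordered : Array → Set
Ordered A = ∀ u v → A !! u , v ≢ 0 → u < v

module Refreshing {n : ℕ} (m limit : ℕ) (cap : 4 + n + (m + m) ≤ limit) (window : List (Update n)) where

  open Passes {n} m limit cap window

  fst⇓ : ∀ {q} → head window ≡ just q → ∀ {t} → Eval t (peek fst (lit 0)) (toℕ (lo (target q)))
  fst⇓ {insert e} w = e-≡ (e-peek e-0) (cong (fieldOf fst) w)
  fst⇓ {delete e} w = e-≡ (e-peek e-0) (cong (fieldOf fst) w)

  snd⇓ : ∀ {q} → head window ≡ just q → ∀ {t} → Eval t (peek snd (lit 0)) (toℕ (hi (target q)))
  snd⇓ {insert e} w = e-≡ (e-peek e-0) (cong (fieldOf snd) w)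
  snd⇓ {delete e} w = e-≡ (e-peek e-0) (cong (fieldOf snd) w)

  kind⇓ : ∀ {q} → head window ≡ just q → ∀ {t} → Eval t (peek kind (lit 0)) (fieldOf kind (just q))
  kind⇓ w = e-≡ (e-peek e-0) (cong (fieldOf kind) w)

  -- A slot before `b` is visited by two passes at costs 36 and 44, a slot from `b` on at costs 38
  -- and 46; both sums are rounded up to 100.
  refreshCost : ℕ → ℕ
  refreshCost k = 50 + k * 100

  record Refreshed (bu bv A mt A′ mt′ : Array) (x b y : ℕ) : Set where
    open Buffer bu bv
    field
      sym′  : Sym mt′
      valid : Valid A′ mt′
      outer : ∀ {x′ y′} → x′ ≤ x → y ≤ y′ → Dominated A mt x′ y′ → Dominated A′ mt′ x′ y′
      inner : Dominated A mt x y → ∀ {z} → b ≤ z → z ≤ y → Dominated A′ mt′ b z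

  module _ {q : Update n} (w : head window ≡ just q) {s₀ : State} {s x y E : ℕ}
           (r0 : regs s₀ 0 ≡ s) (r1 : regs s₀ 1 ≡ x) (r2 : regs s₀ 2 ≡ y)
           (x≤s : x ≤ s) (s<y : s < y) (y≤E : y ≤ E) (E≤ : E ≤ m + m)
           (sh : Shapes n (m + m) m (shape (mem s₀)))
           (range : PairRange n E (entry (mem s₀) BU) (entry (mem s₀) BV))
           (bu≡ : entry (mem s₀) BU ! s ≡ toℕ (lo (target q)))
           (bv≡ : entry (mem s₀) BV ! s ≡ toℕ (hi (target q)))
           (sym₀ : Sym (entry (mem s₀) MATE))
           (valid₀ : Valid (entry (mem s₀) ADJ) (entry (mem s₀) MATE))
           (ordered : Ordered (applyAdj q (entry (mem s₀) ADJ)))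
    where

    private
      bu = entry (mem s₀) BU
      bv = entry (mem s₀) BV
      A = entry (mem s₀) ADJ
      A′ = applyAdj q A
      b = s + 1
      u = toℕ (lo (target q))
      v = toℕ (hi (target q))
      s<limit : b < limit
      s<limit = fits (B≤cap (≤-trans (≤-reflexive (+-comm s 1)) (≤-trans s<y (≤-trans y≤E (≤-trans E≤ (m≤n+m (m + m) 3))))))
      b≤y : b ≤ y
      b≤y = ≤-trans (≤-reflexive (+-comm s 1)) s<y
      b≤E = ≤-trans b≤y y≤E
      x≤b : x ≤ b
      x≤b = ≤-trans x≤s (m≤m+n s 1)

      x⇓ : ∀ {t} → regs t 1 ≡ regs s₀ 1 → Eval t (reg 1) x
      x⇓ e = e-reg (trans e r1)

      y⇓ : ∀ {t} → regs t 2 ≡ regs s₀ 2 → Eval t (reg 2) y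
      y⇓ e = e-reg (trans e r2)

      b⇓ : ∀ {t} → regs t 0 ≡ regs s₀ 0 → Eval t (op add (reg 0) (lit 1)) b
      b⇓ e = e-add (e-reg (trans e r0)) e-1 s<limit

    open Buffer bu bv

    RefreshPost : State → Set
    RefreshPost t = Frame (0 ∷ []) (BU ∷ BV ∷ TAB ∷ CT ∷ []) s₀ t × entry (mem t) ADJ ≡ A′ ×
                    Refreshed bu bv A (entry (mem s₀) MATE) A′ (entry (mem t) MATE) x b y

    run-refresh : ∀ k₁ k₂ → b ≡ k₁ + x → y ≡ k₂ + b →
                  Run refresh s₀ (refreshCost (k₁ + k₂)) RefreshPost
    run-refresh k₁ k₂ b≡ y≡ =
      run-≤ (run-seq (run-mono (P₁.run-clear k₁ b≡ sym₀) ≤-refl λ (fr₁ , cl₁ , st₁) → after₁ fr₁ cl₁ st₁))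
            (total k₁ k₂)
      where
      total : ∀ k₁ k₂ → suc (9 + k₁ * 36 + suc (9 + k₂ * 38 + suc (9 + suc (9 + k₁ * 44 + (9 + k₂ * 46)))))
                      ≤ 50 + (k₁ + k₂) * 100
      total k₁ k₂ = m+n≤o⇒m≤o _ (≤-reflexive (lemma k₁ k₂))
        where
        lemma : ∀ k₁ k₂ → suc (9 + k₁ * 36 + suc (9 + k₂ * 38 + suc (9 + suc (9 + k₁ * 44 + (9 + k₂ * 46)))))
                        + (1 + k₁ * 20 + k₂ * 16) ≡ 50 + (k₁ + k₂) * 100
        lemma = solve-∀
      mt₀ = entry (mem s₀) MATE
      nx₀ = entry (mem s₀) NEXT
      module P₁ = Pass {s₀} sh {reg 1} {op add (reg 0) (lit 1)} {lit 0} (λ _ → 0) b≤E E≤ refl refl range (λ _ → e-0)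
                       (λ (_ , (_ , e , _) , _) → x⇓ e) (b⇓ refl)

      after₁ : ∀ {t₁} → Frame (0 ∷ 1 ∷ 2 ∷ []) kept s₀ t₁ → Cleared x b mt₀ (entry (mem t₁) MATE) →
               Stamped (λ _ → 0) x b nx₀ (entry (mem t₁) NEXT) →
               Run _ t₁ (suc (9 + k₂ * 38 + suc (9 + suc (9 + k₁ * 44 + (9 + k₂ * 46))))) RefreshPost
      after₁ {t₁} fr₁@(sh₁ , (r₁0 , r₁1 , r₁2 , _) , (bu₁ , bv₁ , A₁ , _)) cl₁ st₁ =
        run-seq (run-mono (P₂.run-clear k₂ y≡ (Cleared.sym′ cl₁)) ≤-refl λ {t₂} (fr₂ , cl₂ , st₂) →
          after₂ (frame-trans (0 ∷ 1 ∷ 2 ∷ []) kept {s₀} {t₁} {t₂} fr₁ fr₂)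
                 (cleared-++ x≤b b≤y cl₁ cl₂) st₂)
        where
        sh₁′ : Shapes n (m + m) m (shape (mem t₁))
        sh₁′ = subst (Shapes n (m + m) m) (sym sh₁) sh
        module P₂ = Pass {t₁} sh₁′ {op add (reg 0) (lit 1)} {reg 2} {reg 3} (λ r → r) y≤E E≤ bu₁ bv₁ range e-reg
                         (λ (_ , (e , _) , _) → b⇓ (trans e r₁0)) (y⇓ r₁2)
        nx₁ = entry (mem t₁) NEXT

        after₂ : ∀ {t₂} → Frame (0 ∷ 1 ∷ 2 ∷ []) kept s₀ t₂ → Cleared x y mt₀ (entry (mem t₂) MATE) →
                 Stamped (λ r → r) b y nx₁ (entry (mem t₂) NEXT) →
                 Run _ t₂ (suc (9 + suc (9 + k₁ * 44 + (9 + k₂ * 46)))) RefreshPost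
        after₂ {t₂} fr₂@(sh₂ , (r₂0 , r₂1 , r₂2 , _) , (bu₂ , bv₂ , A₂ , tab₂ , ct₂ , _)) cl st₂ =
          run-seq (run-put (e2 (fst⇓ {q} w) (snd⇓ {q} w)) (Shapes.adj sh₂′) (<2 (Fin.toℕ<n _) (Fin.toℕ<n _))
                           (e-eq (kind⇓ w) e-1)
            (run-seq (run-mono (P₄.run-try A₃ refl ordered (λ _ _ → y≤E) (λ _ → ≤-refl)
                                           (C.stamp-early) k₁ b≡
                                           (Cleared.sym′ cl) (C.cleared-valid valid₀)
                                           (λ p q e → untouched₂-⊆ x≤b ≤-refl (Cleared.gone₂ cl p q e)))
                               ≤-refl λ (fr₄ , tr₁) → after₄ fr₄ tr₁)))
          where
          sh₂′ : Shapes n (m + m) m (shape (mem t₂))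
          sh₂′ = subst (Shapes n (m + m) m) (sym sh₂) sh
          nx₂ = entry (mem t₂) NEXT
          mt₂ = entry (mem t₂) MATE
          t₃ = putEntry ADJ (u ∷ v ∷ []) (bit (fieldOf kind (just q) ≡ᵇ 1)) t₂
          A₃ : entry (mem t₃) ADJ ≡ A′
          A₃ = cong (applyAdj q) A₂
          0<b : 0 < b
          0<b = ≤-trans (s≤s z≤n) (≤-reflexive (+-comm 1 s))
          A≡ : ∀ i j → Untouched x y i j → A′ !! i , j ≡ A !! i , j
          A≡ i j un = update-≢ {u ∷ v ∷ []} A {i ∷ j ∷ []} (λ { refl → un s x≤s s<y (bu≡ , bv≡) })
          module C = Sweep A A′ mt₀ mt₂ nx₀ nx₁ nx₂ x≤b b≤y 0<b A≡ cl st₁ st₂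
          module P₄ = Pass {t₃} sh₂′ {reg 1} {op add (reg 0) (lit 1)} {lit 0} (λ _ → 0) b≤E E≤ bu₂ bv₂ range (λ _ → e-0)
                           (λ (_ , (_ , e , _) , _) → x⇓ (trans e r₂1)) (b⇓ r₂0)

          after₄ : ∀ {t₄} → Frame (0 ∷ 1 ∷ 2 ∷ []) (NEXT ∷ kept) t₃ t₄ →
                   Tried A′ nx₂ (λ _ → 0) (λ _ → y) b x b mt₂ (entry (mem t₄) MATE) →
                   Run _ t₄ (9 + k₂ * 46) RefreshPost
          after₄ {t₄} (sh₄ , (r₄0 , r₄1 , r₄2 , _) , (nx₄ , bu₄ , bv₄ , A₄ , tab₄ , ct₄ , _)) tr₁ =
            run-mono (P₅.run-try (trans A₄ A₃) nx₄ ordered (λ r r<y → ≤-trans (<⇒≤ r<y) y≤E) n≤1+n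
                                 (C.stamp-future) k₂ y≡
                                 (Tried.sym′ tr₁) (Tried.valid tr₁) (Tried.late tr₁))
                     ≤-refl λ {t₅} ((sh₅ , (r₅0 , _) , (_ , bu₅ , bv₅ , A₅ , tab₅ , ct₅ , _)) , tr₂) →
              (trans sh₅ (trans sh₄ sh₂) , (trans r₅0 (trans r₄0 r₂0) , tt) ,
               (trans bu₅ (trans bu₄ bu₂) , trans bv₅ (trans bv₄ bv₂) ,
                trans tab₅ (trans tab₄ tab₂) , trans ct₅ (trans ct₄ ct₂) , tt)) ,
              trans A₅ (trans A₄ A₃) ,
              record
                { sym′  = Tried.sym′ tr₂
                ; valid = Tried.valid tr₂
                ; outer = C.dominated-outer (entry (mem t₄) MATE) (entry (mem t₅) MATE) tr₁ tr₂
                ; inner = C.dominated-inner (entry (mem t₄) MATE) (entry (mem t₅) MATE) tr₁ tr₂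
                }
            where
            module P₅ = Pass {t₄} (subst (Shapes n (m + m) m) (sym sh₄) sh₂′) {op add (reg 0) (lit 1)} {reg 2} {reg 3} (λ r → r)
                             y≤E E≤ (trans bu₄ bu₂) (trans bv₄ bv₂) range e-reg
                             (λ (_ , (e , _) , _) → b⇓ (trans e (trans r₄0 r₂0))) (y⇓ (trans r₄2 r₂2))

-- Starting a phase: compacting the buffer and reading ahead

Between : ∀ {n} → Edge n → ℕ → ℕ → Set
Between e u v = toℕ (lo e) ≡ u × toℕ (hi e) ≡ v

record Represents {n} (A : Array) (G : Graph n) : Set where
  field
    edge-adj : ∀ {e} → e ∈ G → A !! toℕ (lo e) , toℕ (hi e) ≢ 0
    adj-edge : ∀ u v → A !! u , v ≢ 0 → ∃[ e ] e ∈ G × Between e u v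

-- Compaction of the buffer: slots below r are still to be scanned, slots from r
-- to e - 1 hold the distinct edges found so far.  An edge is yet to be found
-- exactly while NEXT is below ADJ, and `pending` lists these edges.
record Compacted {n} (G : Graph n) (A bu bv nx : Array) (r e : ℕ) : Set where
  open Buffer bu bv
  field
    found   : ℕ
    pending : Graph n
    end≡    : e ≡ found + r
    count   : found + length pending ≤ length G
    pends   : ∀ u v → nx !! u , v < A !! u , v → ∃[ g ] g ∈ pending × Between g u v
    located : ∀ u v → A !! u , v ≢ 0 →
              (nx !! u , v < A !! u , v × ∃[ i ] i < r × Hit i u v) ⊎
              (∃[ i ] r ≤ i × i < e × Hit i u v)

module _ {n} {G : Graph n} {A bu bv nx : Array} {r e : ℕ} (c : Compacted G A bu bv nx (suc r) e) where

  open Compacted c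
  open Buffer bu bv

  private
    u = bu ! r
    v = bv ! r

  -- Keeping a slot moves one edge from `pending` to `found`, so `count` limits the kept slots by
  -- the size of the graph. Raising `NEXT` to `ADJ` makes every further occurrence of the pair look
  -- stale.
  compacted-keep : nx !! u , v < A !! u , v →
                   Compacted G A bu bv (update (u ∷ v ∷ []) (A !! u , v) nx) r e
  compacted-keep nx<A = record
    { found = suc found
    ; pending = filter keep? pending
    ; end≡ = trans end≡ (+-suc found r)
    ; count = ≤-trans (≤-trans (≤-reflexive (sym (+-suc found _)))
                               (+-monoʳ-≤ found (List.filter-notAll keep? pending (ListAny.map (λ { refl ¬e → ¬e refl }) g∈))))
                      count
    ; pends = pends′
    ; located = λ a b A≢ → located′ a b A≢ (List.≡-dec _≟_ (u ∷ v ∷ []) (a ∷ b ∷ []))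
    }
    where
    g = proj₁ (pends u v nx<A)
    g∈ = proj₁ (proj₂ (pends u v nx<A))
    g≡ = proj₂ (proj₂ (pends u v nx<A))
    keep? = λ f → ¬? (f ≟ₑ g)
    nx′ = update (u ∷ v ∷ []) (A !! u , v) nx
    pends′ : ∀ a b → nx′ !! a , b < A !! a , b → ∃[ f ] f ∈ filter keep? pending × Between f a b
    pends′ a b lt′ with List.≡-dec _≟_ (u ∷ v ∷ []) (a ∷ b ∷ [])
    ... | yes refl = contradiction (subst (_< A !! u , v) (update-≡ {u ∷ v ∷ []} nx) lt′) (<-irrefl refl)
    ... | no ≢ab with pends a b (subst (_< A !! a , b) (update-≢ {u ∷ v ∷ []} nx ≢ab) lt′)
    ...   | f , f∈ , f≡ = f , ∈-filter⁺ keep? f∈ (λ { refl → ≢ab (cong₂ (λ i j → i ∷ j ∷ [])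
                              (trans (sym (proj₁ g≡)) (proj₁ f≡)) (trans (sym (proj₂ g≡)) (proj₂ f≡))) }) , f≡
    located′ : ∀ a b → A !! a , b ≢ 0 → _ →
               (nx′ !! a , b < A !! a , b × ∃[ i ] i < r × Hit i a b) ⊎ (∃[ i ] r ≤ i × i < e × Hit i a b)
    located′ a b A≢ (yes refl) = inj₂ (r , ≤-refl , ≤-trans (m≤n+m (suc r) found) (≤-reflexive (sym end≡)) , refl , refl)
    located′ a b A≢ (no ≢ab) with located a b A≢
    ... | inj₂ (i , r≤ , i<e , h) = inj₂ (i , <⇒≤ r≤ , i<e , h)
    ... | inj₁ (lt′ , i , s≤s i≤r , h) with m≤n⇒m<n∨m≡n i≤r
    ...   | inj₁ i<r  = inj₁ (subst (_< A !! a , b) (sym (update-≢ {u ∷ v ∷ []} nx ≢ab)) lt′ , i , i<r , h)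
    ...   | inj₂ refl = contradiction (cong₂ (λ i j → i ∷ j ∷ []) (proj₁ h) (proj₂ h)) ≢ab

  -- The hole at `r` is filled with the last kept slot. If nothing has been kept yet, that slot is
  -- `r` itself and the new kept range is empty. No pending edge is lost, since the pair at `r` is
  -- absent or already found.
  compacted-drop : ∀ {e′} → e ≡ suc e′ → ¬ (nx !! u , v < A !! u , v) →
                   Compacted G A (update (r ∷ []) (bu ! e′) bu) (update (r ∷ []) (bv ! e′) bv) nx r e′
  compacted-drop {e′} refl nx≮A = record
    { found = found ; pending = pending
    ; end≡ = suc-injective (trans end≡ (+-suc found r))
    ; count = count ; pends = pends ; located = located′ }
    where
    bu′ = update (r ∷ []) (bu ! e′) bu
    bv′ = update (r ∷ []) (bv ! e′) bv
    module B′ = Buffer bu′ bv′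
    moved : ∀ {a b} → Hit e′ a b → B′.Hit r a b
    moved (p , q) = trans (update-≡ {r ∷ []} bu) p , trans (update-≡ {r ∷ []} bv) q
    stays : ∀ {i a b} → r ≢ i → Hit i a b → B′.Hit i a b
    stays r≢i (p , q) = trans (update-≢ bu (∷-≢ r≢i)) p , trans (update-≢ bv (∷-≢ r≢i)) q
    located′ : ∀ a b → A !! a , b ≢ 0 →
               (nx !! a , b < A !! a , b × ∃[ i ] i < r × B′.Hit i a b) ⊎ (∃[ i ] r ≤ i × i < e′ × B′.Hit i a b)
    located′ a b A≢ with located a b A≢
    ... | inj₁ (lt′ , i , s≤s i≤r , h) with m≤n⇒m<n∨m≡n i≤r
    ...   | inj₁ i<r  = inj₁ (lt′ , i , i<r , stays (λ e → <-irrefl (sym e) i<r) h)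
    ...   | inj₂ refl = contradiction (subst (λ (x , y) → nx !! x , y < A !! x , y) (sym (cong₂ _,_ (proj₁ h) (proj₂ h))) lt′) nx≮A
    located′ a b A≢ | inj₂ (i , r<i , s≤s i≤e′ , h) with m≤n⇒m<n∨m≡n i≤e′
    ...   | inj₁ i<e′ = inj₂ (i , <⇒≤ r<i , i<e′ , stays (<⇒≢ r<i) h)
    ...   | inj₂ refl = inj₂ (r , ≤-refl , r<i , moved h)

compactStep readStep newPhase : Cmd
compactStep =
  loadPair ⨾
  ifte (op lt (get NEXT (reg 4 ∷ reg 5 ∷ [])) (get ADJ (reg 4 ∷ reg 5 ∷ [])))
    (put NEXT (reg 4 ∷ reg 5 ∷ []) (get ADJ (reg 4 ∷ reg 5 ∷ [])))
    (set 2 (op sub (reg 2) (lit 1)) ⨾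
     put BU (reg 3 ∷ []) (get BU (reg 2 ∷ [])) ⨾
     put BV (reg 3 ∷ []) (get BV (reg 2 ∷ [])))
readStep =
  put BU (op add (reg 2) (reg 3) ∷ []) (peek fst (reg 3)) ⨾
  put BV (op add (reg 2) (reg 3) ∷ []) (peek snd (reg 3))
newPhase =
  -- Run for its stamps: 0 is the unmarked state from which compaction starts. Whatever it unmatches
  -- lies in the window of the refresh that follows, where it would be discarded as well.
  descend (lit 0) (get CT (lit 1 ∷ [])) (clearStep (lit 0)) ⨾
  set 2 (get CT (lit 1 ∷ [])) ⨾
  descend (lit 0) (get CT (lit 1 ∷ [])) compactStep ⨾
  descend (lit 0) (get CT (lit 2 ∷ [])) readStep ⨾
  put CT (lit 3 ∷ []) (reg 2) ⨾
  put CT (lit 1 ∷ []) (op add (reg 2) (get CT (lit 2 ∷ []))) ⨾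
  set 0 (reg 2) ⨾ set 1 (lit 0) ⨾ set 2 (get CT (lit 1 ∷ []))

Covers : Array → Array → Array → ℕ → Set
Covers A bu bv E = ∀ u v → A !! u , v ≢ 0 → ∃[ i ] i < E × Buffer.Hit bu bv i u v

module PhaseStart {n : ℕ} (m limit : ℕ) (cap : 4 + n + (m + m) ≤ limit) (window : List (Update n)) where

  open Refreshing {n} m limit cap window public
  open Passes {n} m limit cap window public

  module _ (s₀ : State) (sh : Shapes n (m + m) m (shape (mem s₀))) where

    private module S = Shapes sh

    shape⇓ : ∀ {sh′} → sh′ ≡ shape (mem s₀) → ∀ {a ds} → shape (mem s₀) a ≡ just ds → sh′ a ≡ just ds
    shape⇓ refl e = e

    module _ {G : Graph n} {A : Array} {E : ℕ} (A₀ : entry (mem s₀) ADJ ≡ A) (E≤ : E ≤ m + m) where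

      CompactInv : ℕ → State → Set
      CompactInv r t =
        regs t 3 ≡ r × Frame [] (ADJ ∷ MATE ∷ TAB ∷ CT ∷ []) s₀ t × regs t 2 ≤ E ×
        PairRange n E (entry (mem t) BU) (entry (mem t) BV) ×
        Compacted G A (entry (mem t) BU) (entry (mem t) BV) (entry (mem t) NEXT) r (regs t 2)

      compact-step : ∀ r t → 0 ≤ r → r < E → CompactInv (suc r) t →
                     Run compactStep (setReg 3 r t) 30 (CompactInv r)
      compact-step r t _ r<E (_ , fr , e≤E , range , c) =
        run-seq (run-seq (run-set (e-get (e1 (e-reg refl)) (shape⇓ sh≡ S.bu) (<1 r<B) refl)
                         (run-set (e-get (e1 (e-reg refl)) (shape⇓ sh≡ S.bv) (<1 r<B) refl)
        (run-if (e-lt (e-get (e2 (e-reg refl) (e-reg refl)) (shape⇓ sh≡ S.next) (<2 u<n v<n) refl) A⇓)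
          (λ new → run-≤ (run-put (e2 (e-reg refl) (e-reg refl)) (shape⇓ sh≡ S.next) (<2 u<n v<n) A⇓
            (refl , fr , e≤E , range , compacted-keep c (<ᵇ⇒< _ _ (bit≢0 new)))) (m≤m+n 6 8))
          (λ old → run-seq (run-set (e-≡ (e-sub (e-reg refl) e-1 (fits (B≤cap (≤-trans e≤E (≤-trans E≤ (m≤n+m (m + m) 3))))))
                                           (cong (_∸ 1) e≡))
            (run-seq (run-put (e1 (e-reg refl)) (shape⇓ sh≡ S.bu) (<1 r<B) (e-get (e1 (e-reg refl)) (shape⇓ sh≡ S.bu) (<1 (<-≤-trans e′<E E≤)) refl)
                     (run-put (e1 (e-reg refl)) (shape⇓ sh≡ S.bv) (<1 r<B) (e-get (e1 (e-reg refl)) (shape⇓ sh≡ S.bv) (<1 (<-≤-trans e′<E E≤)) refl)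
                       (refl , fr , <⇒≤ e′<E , range′ , compacted-drop c e≡ (λ lt′ → bit≡0 old (<⇒<ᵇ lt′))))))))))))
        where
        sh≡ = proj₁ fr
        A≡ = proj₁ (proj₂ (proj₂ fr))
        bu = entry (mem t) BU
        bv = entry (mem t) BV
        u = bu ! r
        v = bv ! r
        e′ = Compacted.found c + r
        e≡ : regs t 2 ≡ suc e′
        e≡ = trans (Compacted.end≡ c) (+-suc _ r)
        e′<E : e′ < E
        e′<E = subst (_≤ E) e≡ e≤E
        r<B = <-≤-trans r<E E≤
        v<n = proj₂ (range r r<E)
        u<n = ≤-<-trans (proj₁ (range r r<E)) v<n
        A⇓ : Eval (setReg 5 v (setReg 4 u (setReg 3 r t))) (get ADJ (reg 4 ∷ reg 5 ∷ [])) (A !! u , v)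
        A⇓ = e-get (e2 (e-reg refl) (e-reg refl)) (shape⇓ sh≡ S.adj) (<2 u<n v<n) (cong-app (trans A≡ A₀) _)
        range′ : PairRange n E (update (r ∷ []) (bu ! e′) bu) (update (r ∷ []) (bv ! e′) bv)
        range′ i i<E with r ≟ i
        ... | yes refl = subst (λ (x , y) → x ≤ y × y < n)
                           (sym (cong₂ _,_ (update-≡ {r ∷ []} bu) (update-≡ {r ∷ []} bv))) (range e′ e′<E)
        ... | no r≢i   = subst (λ (x , y) → x ≤ y × y < n)
                           (sym (cong₂ _,_ (update-≢ bu (∷-≢ r≢i)) (update-≢ bv (∷-≢ r≢i)))) (range i i<E)

    module _ {K L : ℕ} (K+L≤ : K + L ≤ m + m) where

      upcoming : Field → ℕ → ℕ
      upcoming f k = fieldOf f (head (drop k window))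

      ReadInv : State → ℕ → State → Set
      ReadInv s₁ r t =
        regs t 3 ≡ r × Frame [] (ADJ ∷ MATE ∷ TAB ∷ CT ∷ []) s₀ t × regs t 2 ≡ K ×
        (∀ i → i < K → entry (mem t) BU ! i ≡ entry (mem s₁) BU ! i × entry (mem t) BV ! i ≡ entry (mem s₁) BV ! i) ×
        (∀ k → r ≤ k → k < L → entry (mem t) BU ! (K + k) ≡ upcoming fst k × entry (mem t) BV ! (K + k) ≡ upcoming snd k)

      read-step : ∀ s₁ r t → 0 ≤ r → r < L → ReadInv s₁ (suc r) t → Run readStep (setReg 3 r t) 13 (ReadInv s₁ r)
      read-step s₁ r t _ r<L (_ , fr , r2 , low , high) =
        run-seq (run-put (e1 (e-add (e-reg r2) (e-reg refl) K+r<limit)) (shape⇓ sh≡ S.bu) (<1 K+r<B) (e-peek (e-reg refl))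
                (run-put (e1 (e-add (e-reg r2) (e-reg refl) K+r<limit)) (shape⇓ sh≡ S.bv) (<1 K+r<B) (e-peek (e-reg refl))
                  (refl , fr , r2 , low′ , high′)))
        where
        sh≡ = proj₁ fr
        bu = entry (mem t) BU
        bv = entry (mem t) BV
        bu′ = update (K + r ∷ []) (upcoming fst r) bu
        bv′ = update (K + r ∷ []) (upcoming snd r) bv
        K+r<B : K + r < m + m
        K+r<B = <-≤-trans (+-monoʳ-< K r<L) K+L≤
        K+r<limit : K + r < limit
        K+r<limit = fits (B≤cap (≤-trans (<⇒≤ K+r<B) (m≤n+m (m + m) 3)))
        low′ : ∀ i → i < K → bu′ ! i ≡ entry (mem s₁) BU ! i × bv′ ! i ≡ entry (mem s₁) BV ! i
        low′ i i<K = trans (update-≢ bu (∷-≢ K+r≢i)) (proj₁ (low i i<K)) ,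
                     trans (update-≢ bv (∷-≢ K+r≢i)) (proj₂ (low i i<K))
          where
          K+r≢i : K + r ≢ i
          K+r≢i refl = <⇒≱ i<K (m≤m+n K r)
        high′ : ∀ k → r ≤ k → k < L → bu′ ! (K + k) ≡ upcoming fst k × bv′ ! (K + k) ≡ upcoming snd k
        high′ k r≤k k<L with head-cases k r≤k
        ... | inj₁ refl = update-≡ {K + r ∷ []} bu , update-≡ {K + r ∷ []} bv
        ... | inj₂ r<k = trans (update-≢ bu (∷-≢ K+r≢)) (proj₁ (high k r<k k<L)) ,
                         trans (update-≢ bv (∷-≢ K+r≢)) (proj₂ (high k r<k k<L))
          where
          K+r≢ : K + r ≢ K + k
          K+r≢ e = <⇒≢ r<k (+-cancelˡ-≡ K r k e)

  PhasePost : State → ℕ → State → Set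
  PhasePost s₀ L t = ∃[ K ] K ≤ m ×
    Frame [] (ADJ ∷ TAB ∷ []) s₀ t × regs t 0 ≡ K × regs t 1 ≡ 0 × regs t 2 ≡ K + L ×
    (entry (mem t) CT ! 1 ≡ K + L × entry (mem t) CT ! 2 ≡ L × entry (mem t) CT ! 3 ≡ K) ×
    Sym (entry (mem t) MATE) × Valid (entry (mem t) ADJ) (entry (mem t) MATE) ×
    PairRange n (K + L) (entry (mem t) BU) (entry (mem t) BV) ×
    Covers (entry (mem t) ADJ) (entry (mem t) BU) (entry (mem t) BV) (K + L) ×
    (∀ k → k < L → entry (mem t) BU ! (K + k) ≡ fieldOf fst (head (drop k window)) ×
                   entry (mem t) BV ! (K + k) ≡ fieldOf snd (head (drop k window)))

  phaseCost : ℕ → ℕ → ℕ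
  phaseCost E L = 60 + E * 100 + L * 100

  fields-range : 0 < n → ∀ (q : Maybe (Update n)) → fieldOf fst q ≤ fieldOf snd q × fieldOf snd q < n
  fields-range 0<n nothing           = z≤n , 0<n
  fields-range 0<n (just (insert (edge a b a<b))) = <⇒≤ (recompute (toℕ a <? toℕ b) a<b) , Fin.toℕ<n b
  fields-range 0<n (just (delete (edge a b a<b))) = <⇒≤ (recompute (toℕ a <? toℕ b) a<b) , Fin.toℕ<n b

  module _ {G : Graph n} {s₀ : State} {E L : ℕ} (0<n : 0 < n)
           (sh : Shapes n (m + m) m (shape (mem s₀))) (E≤ : E ≤ m + m) (L≤ : L ≤ m)
           (E≡ : entry (mem s₀) CT ! 1 ≡ E) (L≡ : entry (mem s₀) CT ! 2 ≡ L)
           (range : PairRange n E (entry (mem s₀) BU) (entry (mem s₀) BV))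
           (covers : Covers (entry (mem s₀) ADJ) (entry (mem s₀) BU) (entry (mem s₀) BV) E)
           (rep : Represents (entry (mem s₀) ADJ) G) (G≤ : length G ≤ m)
           (sym₀ : Sym (entry (mem s₀) MATE)) (valid₀ : Valid (entry (mem s₀) ADJ) (entry (mem s₀) MATE))
    where

    private
      A = entry (mem s₀) ADJ
      bu = entry (mem s₀) BU
      bv = entry (mem s₀) BV

    ct⇓ : ∀ {t} → shape (mem t) ≡ shape (mem s₀) → ∀ i → i < 4 → ∀ {v} → entry (mem t) CT ! i ≡ v →
          Eval t (get CT (lit i ∷ [])) v
    ct⇓ sh≡ i i<4 e = e-get (e1 (e-lit i (≤-trans i<4 4≤limit))) (trans (cong-app sh≡ CT) (Shapes.ct sh)) (<1 i<4) e

    1<4 : 1 < 4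
    1<4 = s≤s (s≤s z≤n)

    m≤2m : ∀ {i} → i ≤ m + m → i < limit
    m≤2m i≤ = fits (B≤cap (≤-trans i≤ (m≤n+m (m + m) 3)))

    run-newPhase : Run newPhase s₀ (phaseCost E L) (PhasePost s₀ L)
    run-newPhase =
      run-≤ (run-seq (run-mono (P.run-clear E (sym (+-identityʳ E)) sym₀) ≤-refl λ (fr , cl , st) → after₁ fr cl st))
            (m+n≤o⇒m≤o _ (≤-reflexive (total E L)))
      where
      total : ∀ E L → suc (8 + E * 36 + suc (3 + suc (8 + E * 39 + suc (8 + L * 22 + suc (3 + suc (6 + suc (2 + suc (2 + 3))))))))
                      + (9 + E * 25 + L * 78) ≡ 60 + E * 100 + L * 100
      total = solve-∀
      module P = Pass {s₀} sh {lit 0} {get CT (lit 1 ∷ [])} {lit 0} (λ _ → 0) ≤-refl E≤ refl refl range (λ _ → e-0)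
                      (λ _ → e-0) (ct⇓ refl 1 1<4 E≡)
      open Buffer bu bv

      after₁ : ∀ {t} → Frame (0 ∷ 1 ∷ 2 ∷ []) kept s₀ t → Cleared 0 E (entry (mem s₀) MATE) (entry (mem t) MATE) →
               Stamped (λ _ → 0) 0 E (entry (mem s₀) NEXT) (entry (mem t) NEXT) →
               Run _ t _ (PhasePost s₀ L)
      after₁ {t} (sh≡ , _ , (bu≡ , bv≡ , A≡ , tab≡ , ct≡ , _)) cl st =
        run-seq (run-set (ct⇓ sh≡ 1 1<4 (trans (cong-app ct≡ _) E≡))
        (run-seq (run-mono
          (run-descend (CompactInv t₁ sh₁ {G = G} A≡ E≤) proj₁ (λ _ → e-0) E (sym (+-identityʳ E)) (m≤2m E≤)
                       (ct⇓ sh≡ 1 1<4 (trans (cong-app ct≡ _) E≡))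
                       (refl , (refl , tt , (refl , refl , refl , refl , tt)) , ≤-refl ,
                        subst₂ bu≡ bv≡ (PairRange n E) range , subst₂ bu≡ bv≡ (λ x y → Compacted G A x y nx E E) compacted₀)
                       (compact-step t₁ sh₁ A≡ E≤))
          ≤-refl λ {t₂} → after₂ {t₂})))
        where
        t₁ = setReg 2 E t
        nx = entry (mem t) NEXT
        sh₁ : Shapes n (m + m) m (shape (mem t₁))
        sh₁ = subst (Shapes n (m + m) m) (sym sh≡) sh
        subst₂ : ∀ {x y : Array} → x ≡ bu → y ≡ bv → (P : Array → Array → Set) → P bu bv → P x y
        subst₂ refl refl P p = p
        compacted₀ : Compacted G A bu bv nx E E
        compacted₀ = record
          { found = 0 ; pending = G ; end≡ = refl ; count = ≤-refl
          ; pends = λ u v nx<A → Represents.adj-edge rep u v (λ A≡0 → n≮0 (subst (_ <_) A≡0 nx<A))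
          ; located = λ u v A≢ → inj₁ (unmarked u v A≢ (st u v) , covers u v A≢) }
          where
          unmarked : ∀ u v → A !! u , v ≢ 0 → _ → nx !! u , v < A !! u , v
          unmarked u v A≢ (inj₁ (un , _)) with covers u v A≢
          ... | i , i<E , h = contradiction h (un i z≤n i<E)
          unmarked u v A≢ (inj₂ (_ , _ , _ , _ , _ , e)) = subst (_< A !! u , v) (sym e) (n≢0⇒n>0 A≢)

        after₂ : ∀ {t₂} → CompactInv t₁ sh₁ {G = G} A≡ E≤ 0 t₂ → Run _ t₂ _ (PhasePost s₀ L)
        after₂ {t₂} (_ , (sh₂ , _ , (A₂ , mt₂ , tab₂ , ct₂ , _)) , K≤E , range₂ , c) =
          run-seq (run-mono
            (run-descend (ReadInv t₁ sh₁ {K} {L} K+L≤ t₂) proj₁ (λ _ → e-0) L (sym (+-identityʳ L)) (m≤2m (≤-trans L≤ (m≤m+n m m)))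
                         (ct⇓ (trans sh₂ sh≡) 2 2<4 ct2)
                         (refl , (sh₂ , tt , (A₂ , mt₂ , tab₂ , ct₂ , tt)) , refl , (λ _ _ → refl , refl) ,
                          λ k L≤k k<L → contradiction L≤k (<⇒≱ k<L))
                         (read-step t₁ sh₁ K+L≤ t₂))
            ≤-refl λ {t₃} → after₃ {t₃})
          where
          open Compacted c
          K = regs t₂ 2
          K≡ : K ≡ found
          K≡ = trans end≡ (+-identityʳ found)
          -- The kept slots are counted against distinct edges of the current graph. Together with
          -- `L ≤ m` this is the origin of the buffer length `m + m`.
          K≤m : K ≤ m
          K≤m = ≤-trans (≤-reflexive K≡) (≤-trans (m≤m+n found _) (≤-trans count G≤))
          K+L≤ : K + L ≤ m + m
          K+L≤ = +-mono-≤ K≤m L≤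
          2<4 : 2 < 4
          2<4 = s≤s (s≤s (s≤s z≤n))
          ct2 : entry (mem t₂) CT ! 2 ≡ L
          ct2 = trans (cong-app (trans ct₂ ct≡) _) L≡

          after₃ : ∀ {t₃} → ReadInv t₁ sh₁ {K} {L} K+L≤ t₂ 0 t₃ → Run _ t₃ _ (PhasePost s₀ L)
          after₃ {t₃} (_ , (sh₃ , _ , (A₃ , mt₃ , tab₃ , ct₃ , _)) , r2 , low , high) =
            run-seq (run-put (e1 (e-lit 3 4≤limit)) shct (<1 ≤-refl) (e-reg r2)
            (run-seq (run-put (e1 e-1) shct (<1 1<4) (e-add (e-reg r2) (e-get (e1 (e-lit 2 (<-trans (n<1+n 2) 4≤limit))) shct (<1 2<4) ct2′) (m≤2m K+L≤))
            (run-seq (run-set (e-reg r2) (run-seq (run-set e-0 (run-set (e-get (e1 e-1) shct (<1 1<4) refl)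
              (K , K≤m , (trans sh₃ sh≡ , tt , (trans A₃ A≡ , trans tab₃ tab≡ , tt)) , refl , refl , refl , (refl , ct2′ , refl) ,
               subst Sym (sym mt₃) (Cleared.sym′ cl) ,
               (λ p q e → valid′ p q (Cleared.back cl p q (trans (sym (cong-app mt₃ _)) e))) ,
               range₃ , covers₃ , λ k → high k z≤n)))))))))
            where
            shct : shape (mem t₃) CT ≡ just (4 ∷ [])
            shct = trans (cong-app (trans sh₃ sh≡) CT) (Shapes.ct sh)
            ct2′ : entry (mem t₃) CT ! 2 ≡ L
            ct2′ = trans (cong-app (trans ct₃ ct≡) _) L≡
            A₃₀ : entry (mem t₃) ADJ ≡ A
            A₃₀ = trans A₃ A≡
            valid′ : ∀ p q → entry (mem s₀) MATE ! p ≡ suc q → entry (mem t₃) ADJ !! p , q ≢ 0 ⊎ entry (mem t₃) ADJ !! q , p ≢ 0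
            valid′ p q e = subst (λ X → X !! p , q ≢ 0 ⊎ X !! q , p ≢ 0) (sym A₃₀) (valid₀ p q e)
            range₃ : PairRange n (K + L) (entry (mem t₃) BU) (entry (mem t₃) BV)
            range₃ i i< with i <? K
            ... | yes i<K = subst (λ (x , y) → x ≤ y × y < n) (sym (cong₂ _,_ (proj₁ (low i i<K)) (proj₂ (low i i<K))))
                                  (range₂ i (<-≤-trans i<K K≤E))
            ... | no i≮K with m≤n⇒∃[o]m+o≡n (≮⇒≥ i≮K)
            ...   | k , refl = subst (λ (x , y) → x ≤ y × y < n) (sym (cong₂ _,_ (proj₁ (high k z≤n k<L)) (proj₂ (high k z≤n k<L))))
                                     (fields-range 0<n (head (drop k window)))
              where
              k<L : k < L
              k<L = +-cancelˡ-< K k L i<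
            covers₃ : Covers (entry (mem t₃) ADJ) (entry (mem t₃) BU) (entry (mem t₃) BV) (K + L)
            covers₃ u v A≢ with located u v (λ e → A≢ (trans (cong-app A₃₀ _) e))
            ... | inj₁ (_ , _ , () , _)
            ... | inj₂ (i , _ , i<K , (p , q)) =
              i , ≤-trans i<K (m≤m+n K L) , trans (proj₁ (low i i<K)) p , trans (proj₂ (low i i<K)) q

-- The algorithm

handleCmd locate setupCmd queryCmd : Cmd
locate =
  set 3 (get TAB (op sub (reg 0) (get CT (lit 3 ∷ [])) ∷ [])) ⨾
  set 1 (op sub (op add (reg 0) (lit 1)) (reg 3)) ⨾
  set 2 (op add (reg 0) (reg 3))
handleCmd =
  -- While an update is handled, the visible window is empty only for `m = 0`; then the graph stays
  -- empty and there is nothing to do.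
  ifte (peek kind (lit 0))
    (set 0 (get CT (lit 0 ∷ [])) ⨾
     ifte (op eq (reg 0) (get CT (lit 1 ∷ []))) newPhase locate ⨾
     refresh ⨾
     put CT (lit 0 ∷ []) (op add (reg 0) (lit 1)))
    skip
setupCmd =
  alloc ADJ (reg 0 ∷ reg 0 ∷ []) ⨾
  alloc MATE (reg 0 ∷ []) ⨾
  alloc NEXT (reg 0 ∷ reg 0 ∷ []) ⨾
  alloc BU (op add (reg 1) (reg 1) ∷ []) ⨾
  alloc BV (op add (reg 1) (reg 1) ∷ []) ⨾
  alloc TAB (reg 1 ∷ []) ⨾
  alloc CT (lit 4 ∷ []) ⨾
  set 2 (lit 1) ⨾
  -- Register 2 holds a power of two `h`, and the test is `2 h ≤ m`. The largest power of two
  -- dividing `i` also divides `h + i` exactly when `0 < i < h`, so copying the entries below `h`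
  -- doubles the table.
  while (op lt (op add (reg 2) (reg 2)) (op add (reg 1) (lit 1)))
    (put TAB (reg 2 ∷ []) (reg 2) ⨾
     descend (lit 1) (reg 2) (put TAB (op add (reg 2) (reg 3) ∷ []) (get TAB (reg 3 ∷ []))) ⨾
     set 2 (op add (reg 2) (reg 2))) ⨾
  put CT (lit 2 ∷ []) (reg 2)
queryCmd = set 0 (get MATE (reg 0 ∷ []))

matcher : Algorithm
matcher = record { setup = setupCmd ; handle = handleCmd ; query = queryCmd }

-- Lookahead, and the adjacency matrix as a graph

head-drop-take : ∀ {A : Set} {m k} → k < m → (xs : List A) → head (drop k (take m xs)) ≡ head (drop k xs)
head-drop-take {m = suc m} {zero}  _         []       = refl
head-drop-take {m = suc m} {suc k} _         []       = refl
head-drop-take {m = suc m} {zero}  _         (x ∷ xs) = refl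
head-drop-take {m = suc m} {suc k} (s≤s k<m) (x ∷ xs) = head-drop-take k<m xs

edge-≡ : ∀ {n} {e f : Edge n} → lo e ≡ lo f → hi e ≡ hi f → e ≡ f
edge-≡ {e = edge a b _} {edge c d _} refl refl = refl

between-≡ : ∀ {n} {e f : Edge n} {u v} → Between e u v → Between f u v → e ≡ f
between-≡ (p , q) (p′ , q′) =
  edge-≡ (Fin.toℕ-injective (trans p (sym p′))) (Fin.toℕ-injective (trans q (sym q′)))

ordered-edge : ∀ {n} (e : Edge n) → toℕ (lo e) < toℕ (hi e)
ordered-edge (edge a b a<b) = recompute (toℕ a <? toℕ b) a<b

represents-ordered : ∀ {n A} {G : Graph n} → Represents A G → Ordered A
represents-ordered rep u v A≢ with Represents.adj-edge rep u v A≢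
... | e , _ , (refl , refl) = ordered-edge e

module _ {n} {A : Array} {G : Graph n} (rep : Represents A G) where

  open Represents rep

  private
    ends : Edge n → List ℕ
    ends e = toℕ (lo e) ∷ toℕ (hi e) ∷ []

    ends-injective : ∀ {e f u v} → ends e ≡ u ∷ v ∷ [] → Between f u v → e ≡ f
    ends-injective e≡ b = between-≡ (List.∷-injectiveˡ e≡ , List.∷-injectiveˡ (List.∷-injectiveʳ e≡)) b

    ends-≢ : ∀ {e f} → f ≢ e → ends e ≢ ends f
    ends-≢ f≢e e≡ = f≢e (sym (ends-injective e≡ (refl , refl)))

  represents-insert : ∀ e → Represents (update (ends e) 1 A) (applyUpdate G (insert e))
  represents-insert e with DecMembership._∈?_ _≟ₑ_ e G
  ... | yes e∈ = record { edge-adj = adj ; adj-edge = back }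
    where
    adj : ∀ {f} → f ∈ G → update (ends e) 1 A (ends f) ≢ 0
    adj {f} f∈ with f ≟ₑ e
    ... | yes refl = λ z → 1+n≢0 (trans (sym (update-≡ {ends e} A)) z)
    ... | no f≢e   = λ z → edge-adj f∈ (trans (sym (update-≢ A (ends-≢ f≢e))) z)
    back : ∀ u v → update (ends e) 1 A !! u , v ≢ 0 → ∃[ f ] f ∈ G × Between f u v
    back u v A≢ with List.≡-dec _≟_ (ends e) (u ∷ v ∷ [])
    ... | yes refl = e , e∈ , refl , refl
    ... | no e≢    = adj-edge u v (λ z → A≢ (trans (update-≢ A e≢) z))
  ... | no e∉ = record { edge-adj = adj ; adj-edge = back }
    where
    adj : ∀ {f} → f ∈ e ∷ G → update (ends e) 1 A (ends f) ≢ 0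
    adj (here refl) = λ z → 1+n≢0 (trans (sym (update-≡ {ends e} A)) z)
    adj {f} (there f∈) with f ≟ₑ e
    ... | yes refl = contradiction f∈ e∉
    ... | no f≢e   = λ z → edge-adj f∈ (trans (sym (update-≢ A (ends-≢ f≢e))) z)
    back : ∀ u v → update (ends e) 1 A !! u , v ≢ 0 → ∃[ f ] f ∈ e ∷ G × Between f u v
    back u v A≢ with List.≡-dec _≟_ (ends e) (u ∷ v ∷ [])
    ... | yes refl = e , here refl , refl , refl
    ... | no e≢ with adj-edge u v (λ z → A≢ (trans (update-≢ A e≢) z))
    ...   | f , f∈ , b = f , there f∈ , b

  represents-delete : ∀ e → Represents (update (ends e) 0 A) (applyUpdate G (delete e))
  represents-delete e = record { edge-adj = adj ; adj-edge = back }
    where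
    keep? = λ f → ¬? (f ≟ₑ e)
    adj : ∀ {f} → f ∈ filter keep? G → update (ends e) 0 A (ends f) ≢ 0
    adj {f} f∈ with ∈-filter⁻ keep? {xs = G} f∈
    ... | f∈G , f≢e = λ z → edge-adj f∈G (trans (sym (update-≢ A (ends-≢ f≢e))) z)
    back : ∀ u v → update (ends e) 0 A !! u , v ≢ 0 → ∃[ f ] f ∈ filter keep? G × Between f u v
    back u v A≢ with List.≡-dec _≟_ (ends e) (u ∷ v ∷ [])
    ... | yes refl = contradiction (update-≡ {ends e} A) A≢
    ... | no e≢ with adj-edge u v (λ z → A≢ (trans (update-≢ A e≢) z))
    ...   | f , f∈ , b = f , ∈-filter⁺ keep? f∈ (λ { refl → e≢ (cong₂ (λ i j → i ∷ j ∷ []) (proj₁ b) (proj₂ b)) }) , b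

  represents-apply : ∀ q → Represents (applyAdj q A) (applyUpdate G q)
  represents-apply (insert e) = represents-insert e
  represents-apply (delete e) = represents-delete e

length≤peak : ∀ {n} (G : Graph n) qs → length G ≤ peakSize G qs
length≤peak G []       = ≤-refl
length≤peak G (q ∷ qs) = m≤m⊔n (length G) _

-- The invariant between updates and the maximal matching it yields

module Maintenance {n : ℕ} (m limit L : ℕ) (cap : 4 + n + (m + m) ≤ limit) (W : Array) where

  Dom : Heap → ℕ → ℕ → Set
  Dom h = Buffer.Dominated (entry h BU) (entry h BV) (entry h ADJ) (entry h MATE)

  -- The buffer consists of the K edges of the graph at the start of the phase
  -- and of the updates of the phase; p is the position of the next update.
  record Inv (K E p : ℕ) (qs : List (Update n)) (G : Graph n) (h : Heap) : Set where
    field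
      shapes : Shapes n (m + m) m (shape h)
      pos    : entry h CT ! 0 ≡ p
      end    : entry h CT ! 1 ≡ E
      len    : entry h CT ! 2 ≡ L
      start  : entry h CT ! 3 ≡ K
      table  : entry h TAB ≡ W
      p≤E    : p ≤ E
      E≤     : E ≤ m + m
      range  : PairRange n E (entry h BU) (entry h BV)
      covers : Covers (entry h ADJ) (entry h BU) (entry h BV) E
      rep    : Represents (entry h ADJ) G
      symm   : Sym (entry h MATE)
      valid  : Valid (entry h ADJ) (entry h MATE)
      link   : ∀ k → p + k < E → entry h BU ! (p + k) ≡ fieldOf fst (head (drop k qs)) ×
                                 entry h BV ! (p + k) ≡ fieldOf snd (head (drop k qs))
      dom    : Dom h p p
      peak   : peakSize G qs ≤ m

  module _ {K E p : ℕ} {qs : List (Update n)} {G : Graph n} {h : Heap} (inv : Inv K E p qs G h) where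

    open Inv inv

    private
      mt = entry h MATE
      A  = entry h ADJ
      matched? = λ (e : Edge n) → mt ! toℕ (lo e) ≟ suc (toℕ (hi e))
      M : Graph n
      M = filter matched? G

    matching-mate : ∀ {e u} → e ∈ M → u isEndOf e → ∃[ v ] mt ! toℕ u ≡ suc (toℕ v) × Joins e u v
    matching-mate {e} e∈ end with proj₂ (∈-filter⁻ matched? {xs = G} e∈)
    matching-mate {e} e∈ (inj₁ refl) | mt≡ = hi e , mt≡ , inj₁ (refl , refl)
    matching-mate {e} e∈ (inj₂ refl) | mt≡ = lo e , symm _ _ mt≡ , inj₂ (refl , refl)

    joins-≡ : ∀ {e f : Edge n} {u v} → Joins e u v → Joins f u v → e ≡ f
    joins-≡ (inj₁ (refl , refl)) (inj₁ (p , q)) = edge-≡ (sym p) (sym q)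
    joins-≡ (inj₂ (refl , refl)) (inj₂ (p , q)) = edge-≡ (sym p) (sym q)
    joins-≡ {e} {f} (inj₁ (refl , refl)) (inj₂ (refl , refl)) = contradiction (ordered-edge f) (<⇒≯ (ordered-edge e))
    joins-≡ {e} {f} (inj₂ (refl , refl)) (inj₁ (refl , refl)) = contradiction (ordered-edge f) (<⇒≯ (ordered-edge e))

    joins-end : ∀ (e : Edge n) u v → Joins e u v → u isEndOf e
    joins-end _ _ _ (inj₁ (refl , _)) = inj₁ refl
    joins-end _ _ _ (inj₂ (_ , refl)) = inj₂ refl

    mate-matching : ∀ u q → mt ! toℕ u ≡ suc q → ∃[ v ] toℕ v ≡ q × ∃[ e ] e ∈ M × Joins e u v
    mate-matching u q mt≡ with valid _ _ mt≡
    ... | inj₁ A≢ with Represents.adj-edge rep _ _ A≢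
    ...   | e , e∈ , (lo≡ , hi≡) = hi e , hi≡ , e ,
      ∈-filter⁺ matched? e∈ (trans (cong (mt !_) lo≡) (trans mt≡ (cong suc (sym hi≡)))) ,
      inj₁ (Fin.toℕ-injective lo≡ , refl)
    mate-matching u q mt≡ | inj₂ A≢ with Represents.adj-edge rep _ _ A≢
    ...   | e , e∈ , (lo≡ , hi≡) = lo e , lo≡ , e ,
      ∈-filter⁺ matched? e∈ (trans (cong (mt !_) lo≡) (trans (symm _ _ mt≡) (cong suc (sym hi≡)))) ,
      inj₂ (refl , Fin.toℕ-injective hi≡)

    isMatching : IsMatching G M
    isMatching = record
      { sub = λ e∈ → proj₁ (∈-filter⁻ matched? {xs = G} e∈)
      ; disjoint = λ e∈ f∈ e≢f u (end , end′) → same e∈ f∈ e≢f (matching-mate e∈ end) (matching-mate f∈ end′) }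
      where
      same : ∀ {e f u} → e ∈ M → f ∈ M → e ≢ f → ∃[ v ] mt ! toℕ u ≡ suc (toℕ v) × Joins e u v →
             ∃[ v ] mt ! toℕ u ≡ suc (toℕ v) × Joins f u v → ⊥
      same _ _ e≢f (v , mt≡ , j) (v′ , mt≡′ , j′)
        with Fin.toℕ-injective {i = v} {v′} (suc-injective (trans (sym mt≡) mt≡′))
      ... | refl = e≢f (joins-≡ j j′)

    -- Take an edge `e` of a larger matching. Domination of the empty window provides a matched end
    -- of `e`; the edge of `M` at that end belongs to the larger matching too and meets `e`, so it
    -- is `e`.
    isMaximal : IsMaximalMatching G M
    isMaximal = isMatching , λ (M′ , match , M⊆ , M′⊈) → M′⊈ λ {e} e∈ → extend match M⊆ e∈
      where
      extend : ∀ {M′ e} → IsMatching G M′ → M ⊆ M′ → e ∈ M′ → e ∈ M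
      extend {M′} {e} match M⊆ e∈ =
        case (dom _ _ (Represents.edge-adj rep (IsMatching.sub match e∈)) (Buffer.untouched-empty (entry h BU) (entry h BV)))
        where
        meet : ∀ u → u isEndOf e → ∀ q → mt ! toℕ u ≡ suc q → e ∈ M
        meet u end q mt≡ with mate-matching u q mt≡
        ... | v , _ , f , f∈ , j with f ≟ₑ e
        ...   | yes refl = f∈
        ...   | no f≢e   = ⊥-elim (IsMatching.disjoint match (M⊆ f∈) e∈ f≢e u (joins-end f u v j , end))
        case : _ ⊎ _ → e ∈ M
        case (inj₁ (q , mt≡ , _)) = meet (lo e) (inj₁ refl) q mt≡
        case (inj₂ (q , mt≡ , _)) = meet (hi e) (inj₂ refl) q mt≡

    has-matching : ∀ {b} → 3 ≤ b → HasMaximalMatching matcher n m limit b qs h G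
    has-matching {b} 3≤b = M , isMaximal , λ u → answer u (mt ! toℕ u) refl
      where
      open Passes {n} m limit cap (take m qs) using (run-set; e-get; e1; e-reg; Run; run)
      Answer : Fin n → Set
      Answer u = ∃[ v ] ∃[ k ] IsMate M u v × Query matcher n m limit qs h u v k × k ≤ b
      ask : ∀ u v → mt ! toℕ u ≡ encode v → ∃[ k ] Query matcher n m limit qs h u v k × k ≤ b
      ask u v mt≡
        with run-set {x = 0} {e = get MATE (reg 0 ∷ [])} {Q = λ t → regs t 0 ≡ encode v × mem t ≡ h}
                     (e-get {⟨ args₁ (toℕ u) , h ⟩} (e1 (e-reg refl)) (Shapes.mate shapes) (<1 (Fin.toℕ<n u)) mt≡) (refl , refl)
      ... | run {⟨ r , .h ⟩} {k} exec k≤3 (r0 , refl) = k , (r , exec , r0) , ≤-trans k≤3 3≤b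
      answer : ∀ u x → mt ! toℕ u ≡ x → Answer u
      answer u zero mt≡ with ask u nothing mt≡
      ... | k , query , k≤ = nothing , k , (λ v e e∈ j → free v e e∈ j (matching-mate e∈ (joins-end e u v j))) , query , k≤
        where
        free : ∀ v e → e ∈ M → Joins e u v → ∃[ v ] mt ! toℕ u ≡ suc (toℕ v) × Joins e u v → ⊥
        free _ _ _ _ (_ , mt≡′ , _) = 0≢1+n (trans (sym mt≡) mt≡′)
      answer u (suc q) mt≡ with mate-matching u q mt≡
      ... | v , refl , e , e∈ , j with ask u (just v) mt≡
      ...   | k , query , k≤ = just v , k , (e , e∈ , j) , query , k≤

-- Handling one update, inside a phase or at its start

dominated-≡ : ∀ {bu bu′ bv bv′ A A′} mt → bu′ ≡ bu → bv′ ≡ bv → A′ ≡ A →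
              ∀ {x y} → Buffer.Dominated bu bv A mt x y → Buffer.Dominated bu′ bv′ A′ mt x y
dominated-≡ _ refl refl refl d = d

-- Opaque, so that comparing bounds never unfolds the numerals.
abstract

  stepFactor phaseFactor : ℕ
  stepFactor  = 400
  phaseFactor = 1100

  -- For table entry `suc w` the window has `suc w` positions up to and including the update and `w`
  -- after it.
  step-bound : ∀ w → 13 + (18 + (56 + (suc w + w) * 100)) ≤ suc w * stepFactor
  step-bound w = m+n≤o⇒m≤o _ (≤-reflexive (lemma w))
    where
    lemma : ∀ w → 13 + (18 + (56 + (suc w + w) * 100)) + (213 + w * 200) ≡ suc w * 400
    lemma = solve-∀

  -- The old buffer has at most `2 m ≤ 4 L` slots to compact, and the first window of the new phase
  -- at most `m + L`, where `L` is `suc l`.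
  phase-bound : ∀ E m l → E ≤ (suc l + suc l) + (suc l + suc l) → m ≤ suc l + suc l →
                13 + ((60 + E * 100 + suc l * 100) + (56 + (suc m + l) * 100)) ≤ suc l * phaseFactor
  phase-bound E m l E≤ m≤ = begin
    13 + ((60 + E * 100 + suc l * 100) + (56 + (suc m + l) * 100))            ≡⟨ expand E m l ⟩
    E * 100 + (m * 100 + (l * 200 + 329))                                     ≤⟨ +-monoˡ-≤ _ (*-monoˡ-≤ 100 E≤) ⟩
    (suc l + suc l + (suc l + suc l)) * 100 + (m * 100 + (l * 200 + 329))     ≤⟨ +-monoʳ-≤ ((suc l + suc l + (suc l + suc l)) * 100) (+-monoˡ-≤ _ (*-monoˡ-≤ 100 m≤)) ⟩
    (suc l + suc l + (suc l + suc l)) * 100 + ((suc l + suc l) * 100 + (l * 200 + 329)) ≡⟨ collect l ⟩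
    l * 800 + 929                                                             ≤⟨ +-mono-≤ (*-monoʳ-≤ l (m≤m+n 800 300)) (m≤m+n 929 171) ⟩
    l * 1100 + 1100                                                           ≡⟨ +-comm (l * 1100) 1100 ⟩
    suc l * 1100                                                              ∎
    where
    open ≤-Reasoning
    expand : ∀ E m l → 13 + ((60 + E * 100 + suc l * 100) + (56 + (suc m + l) * 100)) ≡ E * 100 + (m * 100 + (l * 200 + 329))
    expand = solve-∀
    collect : ∀ l → (suc l + suc l + (suc l + suc l)) * 100 + ((suc l + suc l) * 100 + (l * 200 + 329)) ≡ l * 800 + 929
    collect = solve-∀

module Handling {n : ℕ} (m limit L′ : ℕ) (cap : 4 + n + (m + m) ≤ limit) (0<m : 0 < m)
                (L≤m : suc L′ ≤ m) (m≤2L : m ≤ suc L′ + suc L′) (W : Array) where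

  L : ℕ
  L = suc L′

  open Maintenance {n} m limit L cap W public

  -- The common meeting point of `locate` and `newPhase`, so that the run of `advance` is verified
  -- once for both.
  record Ready (K E p x y : ℕ) (q : Update n) (qs : List (Update n)) (G : Graph n) (s : State) : Set where
    field
      r0     : regs s 0 ≡ p
      r1     : regs s 1 ≡ x
      r2     : regs s 2 ≡ y
      x≤p    : x ≤ p
      p<y    : p < y
      y≤E    : y ≤ E
      E≤     : E ≤ m + m
      shapes : Shapes n (m + m) m (shape (mem s))
      end    : entry (mem s) CT ! 1 ≡ E
      len    : entry (mem s) CT ! 2 ≡ L
      start  : entry (mem s) CT ! 3 ≡ K
      table  : entry (mem s) TAB ≡ W
      range  : PairRange n E (entry (mem s) BU) (entry (mem s) BV)
      covers : Covers (entry (mem s) ADJ) (entry (mem s) BU) (entry (mem s) BV) E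
      rep    : Represents (entry (mem s) ADJ) G
      symm   : Sym (entry (mem s) MATE)
      valid  : Valid (entry (mem s) ADJ) (entry (mem s) MATE)
      link   : ∀ k → p + k < E → entry (mem s) BU ! (p + k) ≡ fieldOf fst (head (drop k (q ∷ qs))) ×
                                 entry (mem s) BV ! (p + k) ≡ fieldOf snd (head (drop k (q ∷ qs)))
      peak   : peakSize G (q ∷ qs) ≤ m
      domxy  : Dom (mem s) x y

  fst-target : ∀ (q : Update n) → fieldOf fst (just q) ≡ toℕ (lo (target q))
  fst-target (insert _) = refl
  fst-target (delete _) = refl

  snd-target : ∀ (q : Update n) → fieldOf snd (just q) ≡ toℕ (hi (target q))
  snd-target (insert _) = refl
  snd-target (delete _) = refl

  head-take : ∀ (q : Update n) qs → head (take m (q ∷ qs)) ≡ just q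
  head-take q qs = head-drop-take 0<m (q ∷ qs)

  Stepped : (K E p x y : ℕ) (q : Update n) (qs : List (Update n)) (G : Graph n) (h h′ : Heap) → Set
  Stepped K E p x y q qs G h h′ =
    Inv K E (suc p) qs (applyUpdate G q) h′ ×
    (∀ x′ y′ → x′ ≤ x → y ≤ y′ → Dom h x′ y′ → Dom h′ x′ y′) ×
    (∀ z → suc p ≤ z → z ≤ y → Dom h′ (suc p) z)

  advance : Cmd
  advance = refresh ⨾ put CT (lit 0 ∷ []) (op add (reg 0) (lit 1))

  module _ {K E p x y q qs G s} (ready : Ready K E p x y q qs G s) where

    open Ready ready
    open PhaseStart {n} m limit cap (take m (q ∷ qs))

    private
      p+0<E : p + 0 < E
      p+0<E = subst (_< E) (sym (+-identityʳ p)) (<-≤-trans p<y y≤E)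
      bu≡ : entry (mem s) BU ! p ≡ toℕ (lo (target q))
      bu≡ = trans (cong (entry (mem s) BU !_) (sym (+-identityʳ p))) (trans (proj₁ (link 0 p+0<E)) (fst-target q))
      bv≡ : entry (mem s) BV ! p ≡ toℕ (hi (target q))
      bv≡ = trans (cong (entry (mem s) BV !_) (sym (+-identityʳ p))) (trans (proj₂ (link 0 p+0<E)) (snd-target q))
      p+1≡ : p + 1 ≡ suc p
      p+1≡ = +-comm p 1
      p+1<limit : p + 1 < limit
      p+1<limit = fits (B≤cap (≤-trans (≤-reflexive p+1≡) (≤-trans p<y (≤-trans y≤E (≤-trans E≤ (m≤n+m (m + m) 3))))))

    run-advance : ∀ k₁ k₂ → suc p ≡ k₁ + x → y ≡ k₂ + suc p →
                  Run advance s (56 + (k₁ + k₂) * 100) (λ t → Stepped K E p x y q qs G (mem s) (mem t))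
    run-advance k₁ k₂ sp≡ y≡ =
      run-≤ (run-seq (run-mono
        (run-refresh (head-take q qs) r0 r1 r2 x≤p p<y y≤E E≤ shapes range bu≡ bv≡ symm valid
                     (represents-ordered (represents-apply rep q)) k₁ k₂ (trans p+1≡ sp≡) (trans y≡ (cong (k₂ +_) (sym p+1≡))))
        ≤-refl λ {t} → finish {t}))
        (≤-reflexive (lemma k₁ k₂))
      where
      lemma : ∀ k₁ k₂ → suc (50 + (k₁ + k₂) * 100 + 5) ≡ 56 + (k₁ + k₂) * 100
      lemma = solve-∀
      finish : ∀ {t} → _ → Run (put CT (lit 0 ∷ []) (op add (reg 0) (lit 1))) t 5
                               (λ t′ → Stepped K E p x y q qs G (mem s) (mem t′))
      finish {t} ((sh≡ , (r0≡ , _) , (BU≡ , BV≡ , tab≡ , ct≡ , _)) , A≡ , re) =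
        run-put (e1 e-0) (trans (cong-app sh≡ CT) (Shapes.ct shapes)) (<1 (s≤s z≤n)) (e-add (e-reg (trans r0≡ r0)) e-1 p+1<limit)
          (record
            { shapes = subst (Shapes n (m + m) m) (sym sh≡) shapes
            ; pos = p+1≡
            ; end = trans (cong-app ct≡ _) end
            ; len = trans (cong-app ct≡ _) len
            ; start = trans (cong-app ct≡ _) start
            ; table = trans tab≡ table
            ; p≤E = ≤-trans p<y y≤E
            ; E≤ = E≤
            ; range = λ i i<E → subst (λ (u , v) → u ≤ v × v < n)
                                  (sym (cong₂ _,_ (cong-app BU≡ (i ∷ [])) (cong-app BV≡ (i ∷ [])))) (range i i<E)
            ; covers = λ u v A≢ → relocate u v (covered′ u v (λ e → A≢ (trans (cong-app A≡ _) e)))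
            ; rep = subst (λ A → Represents A (applyUpdate G q)) (sym A≡) (represents-apply rep q)
            ; symm = R.sym′
            ; valid = λ a b e → subst (λ A → A !! a , b ≢ 0 ⊎ A !! b , a ≢ 0) (sym A≡) (R.valid a b e)
            ; link = λ k lt′ → link′ k (subst (_< E) (sym (+-suc p k)) lt′)
            ; dom = inner′ ≤-refl p<y
            ; peak = ≤-trans (m≤n⊔m (length G) _) peak
            } , (λ _ _ x′≤ y≤′ d → dominated-≡ (entry (mem t) MATE) BU≡ BV≡ A≡ (R.outer x′≤ y≤′ d)) , (λ _ → inner′))
        where
        module R = Refreshed re
        inner′ : ∀ {z} → suc p ≤ z → z ≤ y →
                 Buffer.Dominated (entry (mem t) BU) (entry (mem t) BV) (entry (mem t) ADJ) (entry (mem t) MATE) (suc p) z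
        inner′ {z} sp≤z z≤y =
          subst (λ b → Buffer.Dominated (entry (mem t) BU) (entry (mem t) BV) (entry (mem t) ADJ) (entry (mem t) MATE) b z) p+1≡
                (dominated-≡ (entry (mem t) MATE) BU≡ BV≡ A≡ (R.inner domxy (≤-trans (≤-reflexive p+1≡) sp≤z) z≤y))
        A = entry (mem s) ADJ
        covered′ : ∀ u v → applyAdj q A !! u , v ≢ 0 → ∃[ i ] i < E × Buffer.Hit (entry (mem s) BU) (entry (mem s) BV) i u v
        covered′ u v A≢ with List.≡-dec _≟_ (toℕ (lo (target q)) ∷ toℕ (hi (target q)) ∷ []) (u ∷ v ∷ [])
        ... | yes refl = p , <-≤-trans p<y y≤E , bu≡ , bv≡
        ... | no ≢uv   = covers u v (λ e → A≢ (trans (update-≢ A ≢uv) e))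
        relocate : ∀ u v → ∃[ i ] i < E × Buffer.Hit (entry (mem s) BU) (entry (mem s) BV) i u v →
                   ∃[ i ] i < E × Buffer.Hit (entry (mem t) BU) (entry (mem t) BV) i u v
        relocate u v (i , i<E , b , c) = i , i<E , trans (cong-app BU≡ _) b , trans (cong-app BV≡ _) c
        link′ : ∀ k → p + suc k < E →
                entry (mem t) BU ! (suc p + k) ≡ fieldOf fst (head (drop k qs)) ×
                entry (mem t) BV ! (suc p + k) ≡ fieldOf snd (head (drop k qs))
        link′ k lt′ with link (suc k) lt′
        ... | b , c rewrite +-suc p k = trans (cong-app BU≡ _) b , trans (cong-app BV≡ _) c

  kind≢0 : ∀ (q : Update n) → fieldOf kind (just q) ≢ 0
  kind≢0 (insert _) ()
  kind≢0 (delete _) ()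

  open Inv

  module _ {K E p q qs G h} (inv : Inv K E p (q ∷ qs) G h) where

    open PhaseStart {n} m limit cap (take m (q ∷ qs))

    private
      s₀ = ⟨ args₀ , h ⟩

      ctl⇓ : ∀ {t} → shape (mem t) ≡ shape h → ∀ i → i < 4 → ∀ {v} → entry (mem t) CT ! i ≡ v →
            Eval t (get CT (lit i ∷ [])) v
      ctl⇓ sh≡ i i<4 e = e-get (e1 (e-lit i (≤-trans i<4 4≤limit))) (trans (cong-app sh≡ CT) (Shapes.ct (shapes inv))) (<1 i<4) e

      ≤2m⇒< : ∀ {i} → i ≤ 1 + (m + m) → i < limit
      ≤2m⇒< i≤ = fits (B≤cap (≤-trans i≤ (m≤n+m (1 + (m + m)) 2)))

      p<limit : p < limit
      p<limit = ≤2m⇒< (≤-trans (p≤E inv) (≤-trans (E≤ inv) (n≤1+n _)))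

    run-handle : ∀ {b c Q} →
                 (p ≢ E → Run locate (setReg 0 p s₀) b (λ s → Run advance s c Q)) →
                 (p ≡ E → Run newPhase (setReg 0 p s₀) b (λ s → Run advance s c Q)) →
                 Run handleCmd s₀ (13 + (b + c)) Q
    run-handle {b} {c} f g =
      run-≤ (run-if (kind⇓ (head-take q qs))
        (λ _ → run-seq (run-set (ctl⇓ refl 0 (s≤s z≤n) (pos inv)) (run-seq (run-if
          (e-eq (e-reg refl) (ctl⇓ refl 1 (s≤s (s≤s z≤n)) (end inv)))
          (λ same → g (≡ᵇ⇒≡ p E (bit≢0 same)))
          (λ differ → f (λ p≡E → bit≡0 differ (≡⇒≡ᵇ p E p≡E)))))))
        (λ z → contradiction z (kind≢0 q)))
        (≤-reflexive (lemma b c))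
      where
      lemma : ∀ b c → suc (2 + suc (3 + suc (suc (4 + b) + c))) ≡ 13 + (b + c)
      lemma = solve-∀

    handle-within : ∀ {x w y} → K ≤ p → p < E → p ∸ K < m → W ! (p ∸ K) ≡ suc w → p ≡ w + x →
                    y ≡ w + suc p → y ≤ E → Dom h x y →
                    ∃[ h′ ] ∃[ k ] Handle matcher n m limit (q ∷ qs) h h′ k × k ≤ suc w * stepFactor ×
                                   Stepped K E p x y q qs G h h′
    handle-within {x} {w} {y} K≤p p<E i<m W≡ p≡ y≡ y≤E dom = pack (run-handle
      (λ _ → run-seq (run-set tab⇓ (run-seq (run-set
         (e-≡ (e-sub (e-add (e-reg refl) e-1 p+1<limit) (e-reg refl) p+1<limit) x≡)
         (run-set (e-≡ (e-add (e-reg refl) (e-reg refl) (subst (_< limit) (sym y≡′) y<limit)) y≡′)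
           (run-advance ready (suc w) w (cong suc p≡) y≡))))))
      (λ p≡E → contradiction p≡E (<⇒≢ p<E)))
      where
      p+1<limit : p + 1 < limit
      p+1<limit = ≤2m⇒< (≤-trans (≤-reflexive (+-comm p 1)) (s≤s (≤-trans (p≤E inv) (E≤ inv))))
      y<limit : y < limit
      y<limit = ≤2m⇒< (≤-trans y≤E (≤-trans (E≤ inv) (n≤1+n _)))
      x≡ : p + 1 ∸ suc w ≡ x
      x≡ = trans (cong (_∸ suc w) (trans (+-comm p 1) (cong suc p≡))) (m+n∸m≡n w x)
      y≡′ : p + suc w ≡ y
      y≡′ = trans (trans (+-suc p w) (trans (cong suc (+-comm p w)) (sym (+-suc w p)))) (sym y≡)
      tab⇓ : Eval (setReg 0 p s₀) (get TAB (op sub (reg 0) (get CT (lit 3 ∷ [])) ∷ [])) (suc w)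
      tab⇓ = e-get (e1 (e-sub (e-reg refl) (ctl⇓ refl 3 ≤-refl (start inv)) p<limit)) (Shapes.tab (shapes inv)) (<1 i<m)
                   (trans (cong-app (table inv) _) W≡)
      ready : Ready K E p x y q qs G _
      ready = record
        { r0 = refl ; r1 = refl ; r2 = refl
        ; x≤p = ≤-trans (m≤n+m x w) (≤-reflexive (sym p≡))
        ; p<y = ≤-trans (m≤n+m (suc p) w) (≤-reflexive (sym y≡))
        ; y≤E = y≤E ; E≤ = E≤ inv ; shapes = shapes inv ; end = end inv ; len = len inv ; start = start inv
        ; table = table inv ; range = range inv ; covers = covers inv ; rep = rep inv ; symm = symm inv
        ; valid = valid inv ; link = link inv ; peak = peak inv ; domxy = dom }
      pack : Run handleCmd s₀ _ (λ t → Stepped K E p x y q qs G h (mem t)) → _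
      pack (run {t} {k} exec k≤ st) = mem t , k , (regs t , exec) , ≤-trans k≤ (step-bound w) , st

    handle-phase : p ≡ E →
                   ∃[ K′ ] ∃[ h′ ] ∃[ k ] Handle matcher n m limit (q ∷ qs) h h′ k × k ≤ L * phaseFactor ×
                   Inv K′ (K′ + L) (suc K′) qs (applyUpdate G q) h′ ×
                   (∀ z → suc K′ ≤ z → z ≤ K′ + L → Dom h′ (suc K′) z)
    handle-phase p≡E = pack (run-handle
      (λ p≢E → contradiction p≡E p≢E)
      -- The pending update names a vertex, which shows that `n` is positive; reading past the
      -- stream then still produces vertex numbers.
      (λ _ → run-mono (run-newPhase {G} {setReg 0 p s₀} (≤-<-trans z≤n (Fin.toℕ<n (lo (target q)))) (shapes inv) (E≤ inv) L≤m
                         (end inv) (len inv) (range inv) (covers inv) (rep inv)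
                         (≤-trans (length≤peak G (q ∷ qs)) (peak inv)) (symm inv) (valid inv))
               ≤-refl λ {t} → proceed {t}))
      where
      Done : State → Set
      Done t = ∃[ K′ ] Inv K′ (K′ + L) (suc K′) qs (applyUpdate G q) (mem t) ×
               (∀ z → suc K′ ≤ z → z ≤ K′ + L → Dom (mem t) (suc K′) z)
      proceed : ∀ {t} → PhasePost (setReg 0 p s₀) L t → Run advance t (56 + (suc m + L′) * 100) Done
      proceed {t} (K , K≤m , (sh≡ , _ , (A≡ , tab≡ , _)) , r0≡ , r1≡ , r2≡ , (end≡ , len≡ , start≡) , sy , va , ra , co , li) =
        run-mono (run-advance ready (suc K) L′ (sym (+-identityʳ (suc K))) (trans (+-comm K L) (sym (+-suc L′ K))))
                 (+-monoʳ-≤ 56 (*-monoˡ-≤ 100 (+-monoˡ-≤ L′ (s≤s K≤m))))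
                 λ (inv′ , _ , inner) → K , inv′ , inner
        where
        K<K+L : K < K + L
        K<K+L = ≤-trans (s≤s (m≤m+n K L′)) (≤-reflexive (sym (+-suc K L′)))
        link′ : ∀ k → K + k < K + L → entry (mem t) BU ! (K + k) ≡ fieldOf fst (head (drop k (q ∷ qs))) ×
                                      entry (mem t) BV ! (K + k) ≡ fieldOf snd (head (drop k (q ∷ qs)))
        link′ k lt′ = trans (proj₁ (li k k<L)) (cong (fieldOf fst) window≡) , trans (proj₂ (li k k<L)) (cong (fieldOf snd) window≡)
          where
          k<L : k < L
          k<L = +-cancelˡ-< K k L lt′
          window≡ : head (drop k (take m (q ∷ qs))) ≡ head (drop k (q ∷ qs))
          window≡ = head-drop-take (<-≤-trans k<L L≤m) (q ∷ qs)
        domxy′ : Dom (mem t) 0 (K + L)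
        domxy′ u v A≢ un with co u v A≢
        ... | i , i< , hit = contradiction hit (un i z≤n i<)
        ready : Ready K (K + L) K 0 (K + L) q qs G t
        ready = record
          { r0 = r0≡ ; r1 = r1≡ ; r2 = r2≡ ; x≤p = z≤n ; p<y = K<K+L ; y≤E = ≤-refl
          ; E≤ = +-mono-≤ K≤m L≤m
          ; shapes = subst (Shapes n (m + m) m) (sym sh≡) (shapes inv)
          ; end = end≡ ; len = len≡ ; start = start≡
          ; table = trans tab≡ (table inv)
          ; range = ra ; covers = co ; rep = subst (λ A → Represents A G) (sym A≡) (rep inv)
          ; symm = sy ; valid = va ; link = link′ ; peak = peak inv ; domxy = domxy′ }
      pack : Run handleCmd s₀ (13 + (phaseCost E L + (56 + (suc m + L′) * 100))) Done → _
      pack (run {t} {k} exec k≤ (K , inv′ , inner)) =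
        K , mem t , k , (regs t , exec) , ≤-trans k≤ bound , inv′ , inner
        where
        bound : 13 + ((60 + E * 100 + L * 100) + (56 + (suc m + L′) * 100)) ≤ L * phaseFactor
        bound = phase-bound E m L′ (≤-trans (E≤ inv) (+-mono-≤ m≤2L m≤2L)) m≤2L

-- Amortization over dyadic blocks and phases

-- A dyadic block of 2^j updates contains sz j = 2^j - 1 updates after its first.
sz : ℕ → ℕ
sz zero    = 0
sz (suc j) = sz j + suc (sz j)

-- With 2^j dividing i - 1: each of the sz j entries from i on is the largest power
-- of two dividing its index.
Table : Array → ℕ → ℕ → Set
Table W zero    i = ⊤
Table W (suc j) i = Table W j i × W ! (i + sz j) ≡ suc (sz j) × Table W j (i + suc (sz j))

module Amortization {n : ℕ} (m limit J b : ℕ) (cap : 4 + n + (m + m) ≤ limit) (0<m : 0 < m) (3≤b : 3 ≤ b)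
                    (L≤m : suc (sz J) ≤ m) (m≤2L : m ≤ suc (sz J) + suc (sz J)) (W : Array) (table : Table W J 1) where

  open Handling {n} m limit (sz J) cap 0<m L≤m m≤2L W

  Maintained : List (Update n) → Heap → Graph n → ℕ → Set
  Maintained = Maintains matcher n m limit b

  -- The stream may stop inside a block, so the cost bound is a function of the number of updates
  -- made. In `reached` the run so far is a function awaiting the rest of the run; its last
  -- component hands the domination of larger windows back to the enclosing blocks.
  data Outcome (B : ℕ → ℕ) (K E p w : ℕ) (qs : List (Update n)) (G : Graph n) (h : Heap) : Set where
    ended   : ∀ {k} → Maintained qs h G k → k ≤ B (length qs) → Outcome B K E p w qs G h
    reached : ∀ {qs′ G′ h′ k} → (∀ {l} → Maintained qs′ h′ G′ l → Maintained qs h G (k + l)) →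
              k ≤ B w → length qs ≡ w + length qs′ → Inv K E (p + w) qs′ G′ h′ →
              (∀ x y → x ≤ p → p + w ≤ y → Dom h x y → Dom h′ x y) → Outcome B K E p w qs G h

  inv-at : ∀ {K E p p′ qs G h} → p ≡ p′ → Inv K E p qs G h → Inv K E p′ qs G h
  inv-at refl inv = inv

  -- The window of the middle update is the range of the whole call. Its domination, given at the
  -- start, persists through the left half; the middle update then produces domination of all
  -- prefixes of the right half, the hypothesis of the second recursive call. The middle update
  -- costs `suc s` units of `stepFactor`, and exactly `suc s` updates of the call have been made
  -- once it is done. So each level charges an update at most one unit, even if the stream stops
  -- right there.
  block : ∀ j {K E p i qs G h} → Inv K E p qs G h → p ≡ K + i → Table W j i → p + sz j ≤ E → i + sz j ≤ m →
          (∀ z → p ≤ z → z ≤ p + sz j → Dom h p z) →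
          Outcome (λ t → t * (j * stepFactor)) K E p (sz j) qs G h
  block zero {p = p} inv _ _ _ _ _ =
    reached (λ M → M) z≤n refl (inv-at (sym (+-identityʳ p)) inv) (λ _ _ _ _ d → d)
  block (suc j) {K} {E} {p} {i} {qs} {G} {h} inv p≡ (left , mid , right) ≤E ≤m dom = second (block j inv p≡ left p+s≤E i+s≤m dom₁)
    where
    s = sz j
    X = j * stepFactor
    p+s≤ : p + s ≤ p + (s + suc s)
    p+s≤ = +-monoʳ-≤ p (m≤m+n s (suc s))
    p+s≤E = ≤-trans p+s≤ ≤E
    i+s≤m = ≤-trans (+-monoʳ-≤ i (m≤m+n s (suc s))) ≤m
    dom₁ : ∀ z → p ≤ z → z ≤ p + s → Dom h p z
    dom₁ z p≤z z≤ = dom z p≤z (≤-trans z≤ p+s≤)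
    Goal = Outcome (λ t → t * (suc j * stepFactor)) K E p (s + suc s) qs G h
    widen : ∀ t → t * X ≤ t * (suc j * stepFactor)
    widen t = *-monoʳ-≤ t (m≤n+m X stepFactor)
    far : p + (s + suc s) ≡ suc (p + s) + s
    far = trans (cong (p +_) (+-suc s s)) (trans (+-suc p (s + s)) (cong suc (sym (+-assoc p s s))))
    far′ : p + (s + suc s) ≡ s + suc (p + s)
    far′ = trans far (trans (+-comm (suc (p + s)) s) refl)
    second : Outcome (λ t → t * X) K E p s qs G h → Goal
    second (ended M k≤) = ended M (≤-trans k≤ (widen (length qs)))
    second (reached {[]} {G′} {h′} M k≤ len inv′ _) =
      ended (M (done (has-matching inv′ 3≤b)))
            (≤-trans (≤-reflexive (+-identityʳ _)) (≤-trans k≤ (≤-trans (widen s) (*-monoˡ-≤ (suc j * stepFactor) (≤-trans (m≤m+n s 0) (≤-reflexive (sym len)))))))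
    second (reached {q ∷ qs₁} {G₁} {h₁} {k₁} M₁ k₁≤ len₁ inv₁ out₁) =
      middle (handle-within inv₁ {x = p} {w = s} {y = p + (s + suc s)}
             (≤-trans (m≤m+n K i) (≤-trans (≤-reflexive (sym p≡)) (m≤m+n p s)))
             (<-≤-trans (+-monoʳ-< p (m<m+n s (s≤s z≤n))) ≤E)
             (subst (_< m) (sym index) (<-≤-trans (+-monoʳ-< i (m<m+n s (s≤s z≤n))) ≤m))
             (trans (cong (W !_) index) mid)
             (+-comm p s) far′ ≤E
             (out₁ p (p + (s + suc s)) ≤-refl p+s≤ (dom _ (m≤m+n p _) ≤-refl)))
      where
      index : p + s ∸ K ≡ i + s
      index = trans (cong (λ p → p + s ∸ K) p≡) (trans (cong (_∸ K) (+-assoc K i s)) (m+n∸m≡n K (i + s)))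
      middle : ∃[ h₂ ] ∃[ k₂ ] Handle matcher n m limit (q ∷ qs₁) h₁ h₂ k₂ × k₂ ≤ suc s * stepFactor ×
                               Stepped K E (p + s) p (p + (s + suc s)) q qs₁ G₁ h₁ h₂ → Goal
      middle (h₂ , k₂ , run₂ , k₂≤ , inv₂ , out₂ , dom₂) = third
        (block j inv₂ p₂≡ right (≤-trans (≤-reflexive (sym far)) ≤E)
               (≤-trans (≤-reflexive (+-assoc i (suc s) s)) (≤-trans (≤-reflexive (cong (i +_) (+-comm (suc s) s))) ≤m))
               (λ z ≤z z≤ → dom₂ z ≤z (≤-trans z≤ (≤-reflexive (sym far)))))
        where
        p₂≡ : suc (p + s) ≡ K + (i + suc s)
        p₂≡ = trans (cong (λ p → suc (p + s)) p≡) (trans (cong suc (+-assoc K i s)) (trans (sym (+-suc K (i + s))) (cong (K +_) (sym (+-suc i s)))))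
        M₂ : ∀ {l} → Maintained qs₁ h₂ (applyUpdate G₁ q) l → Maintained qs h G (k₁ + (k₂ + l))
        M₂ M = M₁ (step (has-matching inv₁ 3≤b) run₂ M)
        third : Outcome (λ t → t * X) K E (suc (p + s)) s qs₁ (applyUpdate G₁ q) h₂ → Goal
        third (ended {k₃} M₃ k₃≤) = ended (M₂ M₃)
          (≤-trans (+-mono-≤ k₁≤ (+-mono-≤ k₂≤ k₃≤))
          (≤-trans (m+n≤o⇒m≤o _ (≤-reflexive (lemma s (length qs₁) X stepFactor)))
                   (≤-reflexive (cong (_* (suc j * stepFactor)) (sym len₁)))))
          where
          lemma : ∀ s t X c → s * X + (suc s * c + t * X) + (X + t * c) ≡ (s + suc t) * (c + X)
          lemma = solve-∀
        third (reached {k = k₃} M₃ k₃≤ len₃ inv₃ out₃) = reached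
          (λ {l} M → subst (Maintained qs h G) (assoc k₁ k₂ k₃ l) (M₂ (M₃ M)))
          (≤-trans (+-mono-≤ k₁≤ (+-mono-≤ k₂≤ k₃≤)) (m+n≤o⇒m≤o _ (≤-reflexive (lemma s X stepFactor))))
          (trans len₁ (trans (cong (λ t → s + suc t) len₃) (sym (+-assoc s (suc s) _))))
          (inv-at (sym far) inv₃)
          (λ x y x≤p ≤y d → out₃ x y (≤-trans x≤p (≤-trans (m≤m+n p s) (n≤1+n _))) (≤-trans (≤-reflexive (sym far)) ≤y)
                              (out₂ x y x≤p ≤y (out₁ x y x≤p (≤-trans p+s≤ ≤y) d)))
          where
          assoc : ∀ a b c d → a + (b + (c + d)) ≡ a + (b + c) + d
          assoc = solve-∀
          lemma : ∀ s X c → s * X + (suc s * c + s * X) + (s * c + X) ≡ (s + suc s) * (c + X)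
          lemma = solve-∀

  -- A complete phase recovers its starting cost from its own updates; the added `suc (sz J)` pays
  -- for a last phase that is cut short.
  budget : ℕ → ℕ
  budget t = t * (J * stepFactor) + (t + suc (sz J)) * phaseFactor

  -- The stream left after a phase is known only through an equation on lengths, hence the recursion
  -- on a bound for the length.
  phases : ∀ fuel {K E qs G h} → length qs ≤ fuel → Inv K E E qs G h → ∃[ k ] Maintained qs h G k × k ≤ budget (length qs)
  phases _ {qs = []} _ inv = 0 , done (has-matching inv 3≤b) , z≤n
  phases (suc fuel) {qs = q ∷ qs} {G} {h} (s≤s ≤fuel) inv = begin-phase (handle-phase inv refl)
    where
    S = sz J
    X = J * stepFactor
    Result = ∃[ k ] Maintained (q ∷ qs) h G k × k ≤ budget (suc (length qs))
    begin-phase : ∃[ K ] ∃[ h₁ ] ∃[ k₁ ] Handle matcher n m limit (q ∷ qs) h h₁ k₁ × k₁ ≤ suc S * phaseFactor ×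
                  Inv K (K + suc S) (suc K) qs (applyUpdate G q) h₁ ×
                  (∀ z → suc K ≤ z → z ≤ K + suc S → Dom h₁ (suc K) z) → Result
    begin-phase (K , h₁ , k₁ , run₁ , k₁≤ , inv₁ , dom₁) =
      continue (block J inv₁ (+-comm 1 K) table (≤-reflexive end≡) L≤m (λ z ≤z z≤ → dom₁ z ≤z (≤-trans z≤ (≤-reflexive end≡))))
      where
      end≡ : suc K + S ≡ K + suc S
      end≡ = sym (+-suc K S)
      continue : Outcome (λ t → t * X) K (K + suc S) (suc K) S qs (applyUpdate G q) h₁ → Result
      continue (ended {k₂} M k₂≤) =
        k₁ + k₂ , step (has-matching inv 3≤b) run₁ M ,
        ≤-trans (+-mono-≤ k₁≤ k₂≤) (m+n≤o⇒m≤o _ (≤-reflexive (lemma (length qs) S X phaseFactor)))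
        where
        lemma : ∀ t S X D → suc S * D + t * X + (X + suc t * D) ≡ suc t * X + (suc t + suc S) * D
        lemma = solve-∀
      continue (reached {qs₂} {G₂} {h₂} {k₂} M k₂≤ len inv₂ _) =
        next (phases fuel (≤-trans (≤-trans (m≤n+m _ S) (≤-reflexive (sym len))) ≤fuel) (inv-at end≡ inv₂))
        where
        next : ∃[ k ] Maintained qs₂ h₂ G₂ k × k ≤ budget (length qs₂) → Result
        next (k₃ , M₃ , k₃≤) =
          k₁ + (k₂ + k₃) , step (has-matching inv 3≤b) run₁ (M M₃) ,
          ≤-trans (+-mono-≤ k₁≤ (+-mono-≤ k₂≤ k₃≤))
          (≤-trans (m+n≤o⇒m≤o _ (≤-reflexive (lemma (length qs₂) S X phaseFactor)))
                   (≤-reflexive (cong (λ t → budget (suc t)) (sym len))))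
          where
          lemma : ∀ t S X D → suc S * D + (S * X + (t * X + (t + suc S) * D)) + X ≡ suc (S + t) * X + (suc (S + t) + suc S) * D
          lemma = solve-∀

-- Setup: allocation and the table of powers of two

table-copy : ∀ {W W′} j {i i′} → (∀ k → k < sz j → W′ ! (i′ + k) ≡ W ! (i + k)) → Table W j i → Table W′ j i′
table-copy zero _ _ = tt
table-copy {W} {W′} (suc j) {i} {i′} same (left , mid , right) =
  table-copy j (λ k k< → same k (≤-trans k< (m≤m+n s (suc s)))) left ,
  trans (same s (m<m+n s (s≤s z≤n))) mid ,
  table-copy j (λ k k< → trans (cong (W′ !_) (+-assoc i′ (suc s) k))
                        (trans (same (suc s + k) (subst (_< s + suc s) (+-comm k (suc s))
                                                   (subst (k + suc s <_) refl (+-monoˡ-< (suc s) k<))))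
                               (cong (W !_) (sym (+-assoc i (suc s) k))))) right
  where s = sz j

module SettingUp {n : ℕ} (m limit : ℕ) (cap : 4 + n + (m + m) ≤ limit) (4<limit : 4 < limit)
                 (window : List (Update n)) where

  open Passes {n} m limit cap window

  others : List Arr
  others = ADJ ∷ MATE ∷ NEXT ∷ BU ∷ BV ∷ CT ∷ []

  module _ {s₀ : State} (sh : Shapes n (m + m) m (shape (mem s₀))) (r1 : regs s₀ 1 ≡ m) where

    private module S = Shapes sh

    copyStep doubling : Cmd
    copyStep = put TAB (op add (reg 2) (reg 3) ∷ []) (get TAB (reg 3 ∷ []))
    doubling = put TAB (reg 2 ∷ []) (reg 2) ⨾ descend (lit 1) (reg 2) copyStep ⨾ set 2 (op add (reg 2) (reg 2))

    more : Expr
    more = op lt (op add (reg 2) (reg 2)) (op add (reg 1) (lit 1))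

    Stage : ℕ → State → Set
    Stage j t = Frame (1 ∷ []) others s₀ t × regs t 2 ≡ suc (sz j) × Table (entry (mem t) TAB) j 1

    module _ {j : ℕ} {t : State} (h+h≤m : suc (sz j) + suc (sz j) ≤ m) (stage : Stage j t) where

      private
        h = suc (sz j)
        W₀ = entry (mem t) TAB
        W₁ = update (h ∷ []) h W₀
        h<m : h < m
        h<m = ≤-trans (s≤s (m≤n+m h (sz j))) h+h≤m
        ≤m⇒< : ∀ {i} → i ≤ m → i < limit
        ≤m⇒< i≤ = fits (B≤cap (≤-trans i≤ (≤-trans (m≤m+n m m) (m≤n+m (m + m) 3))))

      CopyInv : ℕ → State → Set
      CopyInv r u = regs u 3 ≡ r × Frame (1 ∷ []) others s₀ u × regs u 2 ≡ h ×
                    (∀ i → i ≤ h → entry (mem u) TAB ! i ≡ W₁ ! i) ×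
                    (∀ i → r ≤ i → i < h → entry (mem u) TAB ! (h + i) ≡ W₁ ! i)

      copy-step : ∀ r u → 1 ≤ r → r < h → CopyInv (suc r) u → Run copyStep (setReg 3 r u) 6 (CopyInv r)
      copy-step r u 1≤r r<h (_ , fr , r2 , low , high) =
        run-put (e1 (e-add (e-reg r2) (e-reg refl) (≤m⇒< (<⇒≤ h+r<m)))) sh-tab (<1 h+r<m)
                (e-get (e1 (e-reg refl)) sh-tab (<1 (<-trans r<h h<m)) (low r (<⇒≤ r<h)))
                (refl , fr , r2 , low′ , high′)
        where
        tb = entry (mem u) TAB
        sh-tab : shape (mem u) TAB ≡ just (m ∷ [])
        sh-tab = trans (cong-app (proj₁ fr) TAB) S.tab
        h+r<m : h + r < m
        h+r<m = <-≤-trans (+-monoʳ-< h r<h) h+h≤m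
        tb′ = update (h + r ∷ []) (W₁ ! r) tb
        low′ : ∀ i → i ≤ h → tb′ ! i ≡ W₁ ! i
        low′ i i≤h = trans (update-≢ {h + r ∷ []} {W₁ ! r} tb {i ∷ []} (λ { refl → <⇒≱ (m<m+n h 1≤r) i≤h })) (low i i≤h)
        high′ : ∀ i → r ≤ i → i < h → tb′ ! (h + i) ≡ W₁ ! i
        high′ i r≤i i<h with head-cases i r≤i
        ... | inj₁ refl = update-≡ {h + r ∷ []} tb
        ... | inj₂ r<i  = trans (update-≢ {h + r ∷ []} {W₁ ! r} tb {h + i ∷ []} (∷-≢ λ e → <⇒≢ r<i (+-cancelˡ-≡ h r i e))) (high i r<i i<h)

      run-doubling : Run doubling t (16 + sz j * 15) (Stage (suc j))
      run-doubling =
        run-≤ (run-seq (run-put (e1 (e-reg r2)) sh-tab (<1 h<m) (e-reg r2)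
          (run-seq (run-mono
            (run-descend CopyInv proj₁ (λ _ → e-1) (sz j) (+-comm 1 (sz j)) (≤m⇒< (<⇒≤ h<m)) (e-reg r2)
                         (refl , proj₁ stage , r2 , (λ _ _ → refl) , λ i h≤i i<h → contradiction h≤i (<⇒≱ i<h))
                         copy-step)
            ≤-refl λ {u} (_ , fr , r2′ , low , high) →
              run-set (e-add (e-reg r2′) (e-reg r2′) (≤m⇒< h+h≤m))
                      (fr , refl , table-copy j (λ k k< → trans (low (suc k) (≤-trans k< (n≤1+n _)))
                                                             (update-≢ {h ∷ []} {h} W₀ {suc k ∷ []} (λ { refl → <-irrefl refl k< }))) (proj₂ (proj₂ stage))
                      , trans (low h ≤-refl) (update-≡ {h ∷ []} W₀)
                      , table-copy j (λ k k< → trans (trans (cong (λ x → entry (mem u) TAB ! suc x) (sym (+-suc (sz j) k))) (high (suc k) (s≤s z≤n) (s≤s k<)))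
                                                  (update-≢ {h ∷ []} {h} W₀ {suc k ∷ []} (λ { refl → <-irrefl refl k< }))) (proj₂ (proj₂ stage)))))))
          (≤-reflexive (lemma (sz j)))
        where
        r2 = proj₁ (proj₂ stage)
        sh-tab : shape (mem t) TAB ≡ just (m ∷ [])
        sh-tab = trans (cong-app (proj₁ (proj₁ stage)) TAB) S.tab
        lemma : ∀ s → suc (3 + suc (7 + s * 15 + 4)) ≡ 16 + s * 15
        lemma = solve-∀

    Built : State → Set
    Built t = ∃[ j ] Stage j t × (1 ≤ m → suc (sz j) ≤ m) × m ≤ suc (sz j) + suc (sz j)

    -- `f` acts as a potential: a round with current power `h = suc (sz j)` costs at most `24 * h`
    -- and lowers `f` by `h`. Its bound `g` is the structurally decreasing argument.
    run-build : ∀ g f {j t} → f ≤ g → m ≤ f + suc (sz j) → (1 ≤ m → suc (sz j) ≤ m) → suc (sz j) ≤ suc m → Stage j t →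
                Run (while more doubling) t (8 + f * 24) Built
    run-build g f {j} {t} f≤g m≤ h≤m h≤sm stage = decide (suc (sz j) + suc (sz j) ≤? m)
      where
      h = suc (sz j)
      r2 = proj₁ (proj₂ stage)
      more⇓ : Eval t more (bit (h + h <ᵇ m + 1))
      more⇓ = e-lt (e-add (e-reg r2) (e-reg r2) (fits (B≤cap (≤-trans (+-mono-≤ h≤sm h≤sm) (≤-trans (≤-reflexive (cong suc (+-suc m m))) (n≤1+n _))))))
                   (e-add (e-reg (trans (proj₁ (proj₁ (proj₂ (proj₁ stage)))) r1)) e-1
                          (fits (B≤cap (≤-trans (≤-reflexive (+-comm m 1)) (s≤s (≤-trans (m≤m+n m m) (m≤n+m (m + m) 2)))))))
      decide : _ → Run (while more doubling) t (8 + f * 24) Built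
      decide (no h+h≰m) = run-≤ (run-stop more⇓ stopped (j , stage , h≤m , <⇒≤ (≰⇒> h+h≰m))) (m≤m+n 8 (f * 24))
        where
        stopped : bit (h + h <ᵇ m + 1) ≡ 0
        stopped with h + h <ᵇ m + 1 in eq≡
        ... | false = refl
        ... | true  = contradiction (s≤s⁻¹ (subst (h + h <_) (+-comm m 1) (<ᵇ⇒< (h + h) (m + 1) (subst T (sym eq≡) tt)))) h+h≰m
      decide (yes h+h≤m) = again g f f≤g m≤
        where
        running : bit (h + h <ᵇ m + 1) ≢ 0
        running with h + h <ᵇ m + 1 | <⇒<ᵇ (subst (h + h <_) (+-comm 1 m) (s≤s h+h≤m))
        ... | true | _ = λ ()
        again : ∀ g f → f ≤ g → m ≤ f + h → Run (while more doubling) t (8 + f * 24) Built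
        again g f f≤g m≤f+h with m≤n⇒∃[o]m+o≡n (+-cancelʳ-≤ h h f (≤-trans h+h≤m m≤f+h))
        again (suc g) _ (s≤s f≤g) m≤f+h | f′ , refl =
          run-≤ (run-loop more⇓ running (run-mono (run-doubling h+h≤m stage) ≤-refl λ {u} →
            run-build g f′ (≤-trans (m≤n+m f′ (sz j)) f≤g) (≤-trans m≤f+h (≤-reflexive (shift h f′))) (λ _ → h+h≤m) (≤-trans h+h≤m (n≤1+n m))))
          (≤-trans (m+n≤o⇒m≤o _ (≤-reflexive (lemma (sz j) f′))) ≤-refl)
          where
          shift : ∀ h f → h + f + h ≡ f + (h + h)
          shift = solve-∀
          lemma : ∀ s f → suc (7 + ((16 + s * 15) + (8 + f * 24))) + s * 9 ≡ 8 + (suc s + f) * 24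
          lemma = solve-∀

  record SetUp (t : State) : Set where
    field
      J      : ℕ
      shapes : Shapes n (m + m) m (shape (mem t))
      adj    : ∀ is → entry (mem t) ADJ is ≡ 0
      mate   : ∀ is → entry (mem t) MATE is ≡ 0
      pos    : entry (mem t) CT ! 0 ≡ 0
      end    : entry (mem t) CT ! 1 ≡ 0
      len    : entry (mem t) CT ! 2 ≡ suc (sz J)
      start  : entry (mem t) CT ! 3 ≡ 0
      table  : Table (entry (mem t) TAB) J 1
      L≤m    : 1 ≤ m → suc (sz J) ≤ m
      m≤2L   : m ≤ suc (sz J) + suc (sz J)

  run-setup : Run setupCmd ⟨ args₂ n m , emptyHeap ⟩ (46 + (n * n * 2 + n + m * 29)) SetUp
  run-setup =
    run-≤
    (run-seq (run-alloc (e2 (n⇓ refl) (n⇓ refl)) (run-seq (run-alloc (e1 (n⇓ refl)) (run-seq (run-alloc (e2 (n⇓ refl) (n⇓ refl))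
    (run-seq (run-alloc (e1 (2m⇓ refl)) (run-seq (run-alloc (e1 (2m⇓ refl)) (run-seq (run-alloc (e1 (e-reg refl))
    (run-seq (run-alloc (e1 (e-lit 4 4<limit)) (run-seq (run-set e-1
    (run-seq (run-mono (run-build {s₁} sh refl m m {0} ≤-refl (m≤m+n m 1) (λ 1≤m → 1≤m) (s≤s z≤n)
                 ((refl , (refl , tt) , (refl , refl , refl , refl , refl , refl , tt)) , refl , tt))
              ≤-refl λ {t} → finish {t}))))))))))))))))))
    (≤-reflexive (total n m))
    where
    total : ∀ n m → suc (suc (2 + n * (n * 1)) + suc (suc (1 + n * 1) + suc (suc (2 + n * (n * 1)) + suc (suc (3 + (m + m) * 1) +
              suc (suc (3 + (m + m) * 1) + suc (suc (1 + m * 1) + suc (6 + suc (2 + suc (8 + m * 24 + 3)))))))))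
            ≡ 46 + (n * n * 2 + n + m * 29)
    total = solve-∀
    n⇓ : ∀ {s} → regs s 0 ≡ n → Eval s (reg 0) n
    n⇓ = e-reg
    2m⇓ : ∀ {s} → regs s 1 ≡ m → Eval s (op add (reg 1) (reg 1)) (m + m)
    2m⇓ r = e-add (e-reg r) (e-reg r) (fits (B≤cap (m≤n+m (m + m) 3)))
    s₁ : State
    s₁ = setReg 2 1 (allocArr CT (4 ∷ []) (allocArr TAB (m ∷ []) (allocArr BV (m + m ∷ []) (allocArr BU (m + m ∷ [])
           (allocArr NEXT (n ∷ n ∷ []) (allocArr MATE (n ∷ []) (allocArr ADJ (n ∷ n ∷ []) ⟨ args₂ n m , emptyHeap ⟩)))))))
    sh : Shapes n (m + m) m (shape (mem s₁))
    sh = record { adj = refl ; mate = refl ; next = refl ; bu = refl ; bv = refl ; tab = refl ; ct = refl }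
    finish : ∀ {t} → Built {s₁} sh refl t → Run (put CT (lit 2 ∷ []) (reg 2)) t 3 SetUp
    finish (j , ((sh≡ , _ , (A≡ , mt≡ , _ , _ , _ , ct≡ , _)) , r2 , tab) , L≤m , m≤2L) =
      run-put (e1 (e-lit 2 (<-trans (n<1+n 2) 4≤limit))) (trans (cong-app sh≡ CT) refl) (<1 (s≤s (s≤s (s≤s z≤n)))) (e-reg r2)
        (record
          { J = j ; shapes = subst (Shapes n (m + m) m) (sym sh≡) sh
          ; adj = λ is → cong-app A≡ is ; mate = λ is → cong-app mt≡ is
          ; pos = cong-app ct≡ _ ; end = cong-app ct≡ _ ; len = refl ; start = cong-app ct≡ _
          ; table = tab ; L≤m = L≤m ; m≤2L = m≤2L })

-- Bounds on the peak size, constants and assembly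

length-apply : ∀ {n} (G : Graph n) q → length (applyUpdate G q) ≤ suc (length G)
length-apply G (insert e) with DecMembership._∈?_ _≟ₑ_ e G
... | yes _ = n≤1+n _
... | no  _ = ≤-refl
length-apply G (delete e) = ≤-trans (List.length-filter _ G) (n≤1+n _)

-- From the empty graph this gives `m ≤ t`, hence `L ≤ t`: the starting cost of an unfinished last
-- phase can be charged to the whole stream.
peak≤length : ∀ {n} (G : Graph n) qs → peakSize G qs ≤ length G + length qs
peak≤length G []       = m≤m+n _ 0
peak≤length G (q ∷ qs) = ⊔-lub (m≤m+n _ _)
  (≤-trans (peak≤length (applyUpdate G q) qs)
  (≤-trans (+-monoˡ-≤ (length qs) (length-apply G q)) (≤-reflexive (sym (+-suc (length G) (length qs))))))

unique-apply : ∀ {n} {G : Graph n} q → Unique G → Unique (applyUpdate G q)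
unique-apply {G = G} (insert e) u with DecMembership._∈?_ _≟ₑ_ e G
... | yes _  = u
... | no e∉ = ¬Any⇒All¬ _ e∉ ∷ u
unique-apply (delete e) u = Unique.filter⁺ _ u

unique-lookup : ∀ {A : Set} {xs : List A} → Unique xs → ∀ i j → lookup xs i ≡ lookup xs j → i ≡ j
unique-lookup (_ ∷ _)  Fin.zero    Fin.zero    _ = refl
unique-lookup (x∉ ∷ _) Fin.zero    (Fin.suc j) e = contradiction e (All.lookup x∉ (∈-lookup j))
unique-lookup (x∉ ∷ _) (Fin.suc i) Fin.zero    e = contradiction (sym e) (All.lookup x∉ (∈-lookup i))
unique-lookup (_ ∷ u)  (Fin.suc i) (Fin.suc j) e = cong Fin.suc (unique-lookup u i j e)

-- Distinct edges have distinct pairs of ends. The resulting `m ≤ n * n` puts the buffers and the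
-- table, linear in `m`, within the setup cost.
unique-length : ∀ {n} {G : Graph n} → Unique G → length G ≤ n * n
unique-length {n} {G} u = Fin.injective⇒≤ {f = code} code-injective
  where
  code : Fin (length G) → Fin (n * n)
  code i = Fin.combine (lo (lookup G i)) (hi (lookup G i))
  code-injective : ∀ {i j} → code i ≡ code j → i ≡ j
  code-injective {i} {j} e with Fin.combine-injective _ _ _ _ e
  ... | lo≡ , hi≡ = unique-lookup u i j (edge-≡ lo≡ hi≡)

peak≤n² : ∀ {n} {G : Graph n} qs → Unique G → peakSize G qs ≤ n * n
peak≤n² []       u = unique-length u
peak≤n² (q ∷ qs) u = ⊔-lub (unique-length u) (peak≤n² qs (unique-apply q u))

2^≡ : ∀ j → 2 ^ j ≡ suc (sz j)
2^≡ zero    = refl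
2^≡ (suc j) = trans (cong (2 *_) (2^≡ j)) (cong (λ x → suc (sz j) + x) (+-identityʳ (suc (sz j))))

level≤lg : ∀ j m → suc (sz j) ≤ m → suc j ≤ lg m
level≤lg j m L≤m = s≤s (subst (_≤ ⌊log₂ m ⌋) (⌊log₂[2^n]⌋≡n j) (⌊log₂⌋-mono-≤ (≤-trans (≤-reflexive (2^≡ j)) L≤m)))

-- The exponent is 3 because a square would be only 4 at `n = m = 0`, and the setup program contains
-- the literal 4.
limit-lower : ∀ n m → 8 + n + (m + m) ≤ wordLimit 3 n m
limit-lower n m = m+n≤o⇒m≤o (8 + n + (m + m)) (≤-reflexive (lemma n m))
  where
  lemma : ∀ n m → 8 + n + (m + m) + (n * 11 + m * 10 + 6 * ((n + m) * (n + m)) + (n + m) * ((n + m) * (n + m)))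
                ≡ (2 + n + m) * ((2 + n + m) * ((2 + n + m) * 1))
  lemma = solve-∀

abstract

  setupFactor : ℕ
  setupFactor = 46

  4≤setupFactor : 4 ≤ setupFactor
  4≤setupFactor = m≤m+n 4 42

  linear-bound : ∀ n m x → n ≤ x → m ≤ x → 46 + (x * 2 + n + m * 29) ≤ setupFactor * suc x
  linear-bound n m x n≤x m≤x =
    ≤-trans (+-monoʳ-≤ 46 (+-mono-≤ (+-monoʳ-≤ (x * 2) n≤x) (*-monoˡ-≤ 29 m≤x)))
            (m+n≤o⇒m≤o _ (≤-reflexive (lemma x)))
    where
    lemma : ∀ x → 46 + (x * 2 + x + x * 29) + x * 14 ≡ 46 * suc x
    lemma = solve-∀

-- One constant bounds setup, updates and queries alike. `phaseFactor` counts twice because the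
-- phases are charged for `t + L ≤ 2 t` updates.
costFactor : ℕ
costFactor = setupFactor + (stepFactor + (phaseFactor + phaseFactor))

4≤costFactor : 4 ≤ costFactor
4≤costFactor = ≤-trans 4≤setupFactor (m≤m+n setupFactor _)

idle-bound : ∀ t → t * 4 ≤ costFactor * lg 0 * t
idle-bound t = ≤-trans (≤-reflexive (*-comm t 4)) (*-monoˡ-≤ t (≤-trans 4≤costFactor (m≤m*n costFactor (lg 0))))

setup-bound : ∀ n m → m ≤ n * n → 46 + (n * n * 2 + n + m * 29) ≤ costFactor * suc (n * n * lg m)
setup-bound n m m≤ =
  ≤-trans (linear-bound n m (n * n) (n≤n² n) m≤)
          (*-mono-≤ (m≤m+n setupFactor _) (s≤s (m≤m*n (n * n) (lg m))))
  where
  n≤n² : ∀ n → n ≤ n * n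
  n≤n² zero    = z≤n
  n≤n² (suc n) = m≤m*n (suc n) (suc n)

update-bound : ∀ J m t L → suc J ≤ lg m → L ≤ t →
               t * (J * stepFactor) + (t + L) * phaseFactor ≤ costFactor * lg m * t
update-bound J m t L J< L≤t = begin
  t * (J * c) + (t + L) * D              ≤⟨ +-monoʳ-≤ (t * (J * c)) (*-monoˡ-≤ D (+-monoʳ-≤ t L≤t)) ⟩
  t * (J * c) + (t + t) * D              ≤⟨ m+n≤o⇒m≤o _ (≤-reflexive (lemma J t c D e)) ⟩
  (e + (c + (D + D))) * suc J * t      ≤⟨ *-monoˡ-≤ t (*-monoʳ-≤ (e + (c + (D + D))) J<) ⟩
  costFactor * lg m * t                  ∎
  where
  open ≤-Reasoning
  e = setupFactor
  c = stepFactor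
  D = phaseFactor
  lemma : ∀ J t c D e → t * (J * c) + (t + t) * D + (e * suc J * t + c * t + J * (D + D) * t) ≡ (e + (c + (D + D))) * suc J * t
  lemma = solve-∀

3≤costFactor : 3 ≤ costFactor
3≤costFactor = ≤-trans (n≤1+n 3) 4≤costFactor

module _ {n m : ℕ} (m≤n² : m ≤ n * n) where

  private
    limit = wordLimit 3 n m

    cap : 4 + n + (m + m) ≤ limit
    cap = ≤-trans (m≤n+m _ 4) (limit-lower n m)

    4<limit : 4 < limit
    4<limit = ≤-trans (m≤m+n 5 (3 + n + (m + m))) (limit-lower n m)

  module _ {window : List (Update n)} {t : State} (su : SettingUp.SetUp {n} m limit cap 4<limit window t) where

    open SettingUp.SetUp su
    open Maintenance {n} m limit (suc (sz J)) cap (entry (mem t) TAB)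

    initial : ∀ qs → peakSize [] qs ≤ m → Inv 0 0 0 qs [] (mem t)
    initial qs peak≤m = record
      { shapes = shapes ; pos = pos ; end = end ; len = len ; start = start ; table = refl
      ; p≤E = z≤n ; E≤ = z≤n ; range = λ _ ()
      ; covers = λ u v A≢ → contradiction (adj _) A≢
      ; rep = record { edge-adj = λ () ; adj-edge = λ u v A≢ → contradiction (adj _) A≢ }
      ; symm = λ p q e → contradiction (trans (sym e) (mate _)) 1+n≢0
      ; valid = λ p q e → contradiction (trans (sym e) (mate _)) 1+n≢0
      ; link = λ _ ()
      ; dom = λ u v A≢ → contradiction (adj _) A≢
      ; peak = peak≤m }

    maintain : ∀ qs → peakSize [] qs ≤ m → m ≤ length qs → 1 ≤ m →
               ∃[ k ] Maintains matcher n m limit costFactor qs (mem t) [] k × k ≤ costFactor * lg m * length qs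
    maintain qs peak≤m m≤t 1≤m = finish (A.phases (length qs) ≤-refl (initial qs peak≤m))
      where
      module A = Amortization {n} m limit J costFactor cap 1≤m 3≤costFactor (L≤m 1≤m) m≤2L (entry (mem t) TAB) table
      finish : ∃[ k ] Maintains matcher n m limit costFactor qs (mem t) [] k × k ≤ A.budget (length qs) →
               ∃[ k ] Maintains matcher n m limit costFactor qs (mem t) [] k × k ≤ costFactor * lg m * length qs
      finish (k , M , k≤) = k , M , ≤-trans k≤ (update-bound J m (length qs) (suc (sz J)) (level≤lg J m (L≤m 1≤m)) (≤-trans (L≤m 1≤m) m≤t))

    -- With peak size 0 no insertion can occur, and deleting from the empty graph changes nothing.
    -- Each update costs 4: the failed test of `handleCmd` followed by `skip`.
    idle : ∀ qs → peakSize [] qs ≤ m → m ≡ 0 → ∃[ k ] Maintains matcher n m limit costFactor qs (mem t) [] k × k ≤ length qs * 4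
    idle [] peak≤m m≡0 = 0 , done (has-matching (initial [] peak≤m) 3≤costFactor) , z≤n
    idle (insert e ∷ qs) peak≤m refl = contradiction (≤-trans (length≤peak (e ∷ []) qs) peak≤m) λ ()
    idle (delete e ∷ qs) peak≤m refl = rest (idle qs peak≤m refl)
      where
      rest : ∃[ k ] Maintains matcher n 0 limit costFactor qs (mem t) [] k × k ≤ length qs * 4 →
             ∃[ k ] Maintains matcher n 0 limit costFactor (delete e ∷ qs) (mem t) [] k × k ≤ suc (length qs) * 4
      rest (k , M , k≤) = 4 + k , step (has-matching (initial (delete e ∷ qs) peak≤m) 3≤costFactor)
        (args₀ , Machine.if-else (≤-trans (s≤s z≤n) 4<limit) refl Machine.skip) M , +-monoʳ-≤ 4 k≤

  correct : ∀ qs → peakSize [] qs ≤ m → m ≤ length qs →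
            ∃[ h ] ∃[ setupCost ] ∃[ updateCost ]
              Setup matcher n m limit qs h setupCost × setupCost ≤ costFactor * suc (n * n * lg m) ×
              Maintains matcher n m limit costFactor qs h [] updateCost × updateCost ≤ costFactor * lg m * length qs
  correct qs peak≤m m≤t = assemble (SettingUp.run-setup {n} m limit cap 4<limit (take m qs))
    where
    open Passes {n} m limit cap (take m qs) using (Run; run)
    updates : ∀ {t} → SettingUp.SetUp {n} m limit cap 4<limit (take m qs) t →
              ∃[ k ] Maintains matcher n m limit costFactor qs (mem t) [] k × k ≤ costFactor * lg m * length qs
    updates {t} su = by-size m refl
      where
      Result = ∃[ k ] Maintains matcher n m limit costFactor qs (mem t) [] k × k ≤ costFactor * lg m * length qs
      by-size : ∀ x → m ≡ x → Result
      by-size (suc x) m≡ = maintain su qs peak≤m m≤t (≤-trans (s≤s z≤n) (≤-reflexive (sym m≡)))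
      by-size zero m≡ = relax (idle su qs peak≤m m≡)
        where
        relax : ∃[ k ] Maintains matcher n m limit costFactor qs (mem t) [] k × k ≤ length qs * 4 → Result
        relax (k , M , k≤) = k , M , ≤-trans k≤ (subst (λ m → length qs * 4 ≤ costFactor * lg m * length qs) (sym m≡) (idle-bound (length qs)))
    assemble : Run setupCmd ⟨ args₂ n m , emptyHeap ⟩ _ (SettingUp.SetUp {n} m limit cap 4<limit (take m qs)) → _
    assemble (run {t} {k} exec k≤ su) = let l , M , l≤ = updates su in
      mem t , k , l , (regs t , exec) , ≤-trans k≤ (setup-bound n m m≤n²) , M , l≤

theorem1 : ∃[ A ] ∃[ w ] ∃[ C ] ((n : ℕ) (qs : List (Update n)) →
    let m     = peakSize [] qs
        limit = wordLimit w n m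
    in ∃[ h ] ∃[ setupCost ] ∃[ updateCost ]
         Setup A n m limit qs h setupCost ×
         setupCost ≤ C * suc (n * n * lg m) ×
         Maintains A n m limit C qs h [] updateCost ×
         updateCost ≤ C * lg m * length qs)
theorem1 = matcher , 3 , costFactor , λ n qs → correct (peak≤n² qs []) qs ≤-refl (peak≤length [] qs)
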